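{- Any randomized algorithm in the $\mathsf{CD}$ radio network model that computes with high probability the $s$--$t$ minimum cut size of planar bipartite graphs (for given distinct vertices $s,t$) has energy complexity $\Omega(n)$, where $n$ is the number of vertices.
   Context: Radio network model. A network is a simple connected graph $G=(V,E)$ whose vertices are devices. The topology is initially unknown to the devices, except that $n=|V|$ and the maximum degree $\Delta$ are known to all. Communication proceeds in synchronized rounds with a common start. In each round each device either listens, transmits a message (of unbounded size), or stays idle; it cannot transmit and listen simultaneously. Transmitting and idle devices get no feedback. A listening device $v$ receives the message of $u\in N(v)$ if $u$ is the only transmitting device in $N(v)$. If no device in $N(v)$ transmits, $v$ hears silence. If at least two devices in $N(v)$ transmit, then in the $\mathsf{CD}$ model (with collision detection) $v$ hears "collision". Each device has an unlimited local random source and no other initial distinguishing information, except that each device knows whether it is $s$ or $t$ (identifiers, if used, are generated from local randomness). The energy complexity of an algorithm is the worst-case maximum, over devices, of the number of rounds in which the device is non-idle (listening or transmitting). "With high probability" means with probability $1-1/\mathrm{poly}(n)$. An algorithm computes a quantity if at the end every device knows it. An $s$--$t$ minimum cut is a partition $(X,V\setminus X)$ with $s$ and $t$ in different parts minimizing the number of edges between the two parts; its size is this number of edges. -}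

module Defs where

open import Data.Bool using (Bool; true; false; T; _∧_; not; if_then_else_)
open import Data.Bool.Properties using (T?)
open import Data.Fin using (Fin) renaming (_<_ to _<ᶠ_)
open import Data.Fin.Properties using (all?; nonZeroIndex) renaming (_≟_ to _≟ᶠ_)
open import Data.Fin.Subset using (Subset; _∈_; _∉_; ∣_∣)
open import Data.Integer using (+_)
open import Data.List using (List; []; _∷_; length; map; filter; mapMaybe; allFin;
  cartesianProduct; cartesianProductWith)
open import Data.List.Extrema.Nat using (max)
open import Data.Maybe using (Maybe; just; nothing)
open import Data.Maybe.Properties using (≡-dec)
open import Data.Nat using (ℕ; zero; suc; _≤_; _≟_) renaming (_+_ to _+ℕ_; _*_ to _*ℕ_; _^_ to _^ℕ_)
open import Data.Nat.Properties using (m^n≢0)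
open import Data.Product using (Σ; ∃; ∃-syntax; _×_; _,_)
open import Data.Rational using (ℚ; 0ℚ; 1ℚ; _+_; _*_; _-_; _/_)
  renaming (_≤_ to _≤ℚ_; _<_ to _<ℚ_)
open import Data.Sum using (_⊎_)
open import Data.Vec using (Vec; toList; lookup; tabulate) renaming ([] to []ᵛ; _∷_ to _∷ᵛ_)
open import Relation.Binary.Construct.Closure.ReflexiveTransitive using (Star)
open import Relation.Binary.PropositionalEquality using (_≡_; _≢_)
open import Relation.Nullary using (¬_; does)
open import Relation.Nullary.Decidable using (Dec)

------------------------------------------------------------------------
-- Graphs

record Graph (n : ℕ) : Set where
  field
    adj       : Fin n → Fin n → Bool
    symmetric : ∀ u v → adj u v ≡ adj v u
    loopless  : ∀ v → adj v v ≡ false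

  Adj : Fin n → Fin n → Set
  Adj u v = T (adj u v)

  degree : Fin n → ℕ
  degree v = ∣ tabulate (adj v) ∣

  maxDegree : ℕ
  maxDegree = max 0 (map degree (allFin n))

  Connected : Set
  Connected = ∀ u v → Star Adj u v

  Bipartite : Set
  Bipartite = Σ (Fin n → Bool) λ side → ∀ u v → Adj u v → side u ≢ side v

  -- Each edge between X and its complement is counted exactly once, with its
  -- endpoint in X listed first.
  cutSize : Subset n → ℕ
  cutSize X = length (filter (λ (u , v) → T? (lookup X u ∧ not (lookup X v) ∧ adj u v))
                             (cartesianProduct (allFin n) (allFin n)))

  IsMinCutSize : (s t : Fin n) → ℕ → Set
  IsMinCutSize s t c =
      (∃[ X ] (s ∈ X × t ∉ X × cutSize X ≡ c))
    × (∀ X → s ∈ X → t ∉ X → c ≤ cutSize X)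

------------------------------------------------------------------------
-- Planarity: vertices are distinct points of the plane, edges are simple
-- polygonal arcs joining their endpoints, and the interior of an edge contains
-- no vertex and no point of another edge.  Coordinates are rational, which
-- loses no graph: a polygonal drawing of a finite graph over ℝ can be perturbed
-- to one with rational corners.  Segments with rational ends that meet over ℝ
-- also meet in a rational point, so it suffices to compare rational points.

Point : Set
Point = ℚ × ℚ

OnSegment : Point → Point → Point → Set
OnSegment (px , py) (qx , qy) (x , y) =
  ∃[ θ ] (0ℚ ≤ℚ θ × θ ≤ℚ 1ℚ
        × x ≡ (1ℚ - θ) * px + θ * qx
        × y ≡ (1ℚ - θ) * py + θ * qy)

-- The polygonal path from p to q with the given corners in between.
OnPath : Point → List Point → Point → Point → Set
OnPath p []       q x = OnSegment p q x
OnPath p (b ∷ bs) q x = OnSegment p b x ⊎ OnPath b bs q x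

SimplePath : Point → List Point → Point → Set
SimplePath p []       q = p ≢ q
SimplePath p (b ∷ bs) q =
    p ≢ b
  × (∀ x → OnSegment p b x → OnPath b bs q x → x ≡ b)
  × SimplePath b bs q

-- An edge {u , v} is drawn once, as the pair with u < v.
record PlaneDrawing {n : ℕ} (G : Graph n) : Set where
  open Graph G

  Edge : Fin n → Fin n → Set
  Edge u v = u <ᶠ v × Adj u v

  field
    position : Fin n → Point
    corners  : Fin n → Fin n → List Point

  OnEdge : Fin n → Fin n → Point → Set
  OnEdge u v = OnPath (position u) (corners u v) (position v)

  InteriorOfEdge : Fin n → Fin n → Point → Set
  InteriorOfEdge u v x = OnEdge u v x × x ≢ position u × x ≢ position v

  field
    positions-distinct : ∀ u v → position u ≡ position v → u ≡ v
    edges-simple       : ∀ u v → Edge u v →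
                         SimplePath (position u) (corners u v) (position v)
    avoids-vertices    : ∀ u v → Edge u v → ∀ x → InteriorOfEdge u v x →
                         ∀ w → x ≢ position w
    avoids-edges       : ∀ u v u′ v′ → Edge u v → Edge u′ v′ → ∀ x →
                         InteriorOfEdge u v x → OnEdge u′ v′ x →
                         u ≡ u′ × v ≡ v′

Planar : ∀ {n} → Graph n → Set
Planar G = PlaneDrawing G

record Instance (n : ℕ) : Set where
  field
    graph     : Graph n
    s t       : Fin n
    s≢t       : s ≢ t
    connected : Graph.Connected graph
    planar    : Planar graph
    bipartite : Graph.Bipartite graph

  open Graph graph public

------------------------------------------------------------------------
-- Randomized algorithms in the radio network model with collision detection

data Role : Set where
  source sink ordinary : Role

data Feedback (Message : Set) : Set where
  silence collision : Feedback Message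
  received          : Message → Feedback Message

data Action (Message State : Set) : Set where
  listen   : (Feedback Message → State) → Action Message State
  transmit : Message → State → Action Message State
  idle     : State → Action Message State

-- Coin tosses are local computation and take no time; a device may make any
-- number of them, depending on earlier outcomes, before it acts in a round.
data Instruction (Message State : Set) : Set where
  toss : (Bool → State) → Instruction Message State
  act  : Action Message State → Instruction Message State
  halt : (output : ℕ) → Instruction Message State

-- All devices run the same program.  Initially a device knows only n, Δ and
-- whether it is s or t.
record Algorithm : Set₁ where
  field
    Message State : Set
    start         : (n Δ : ℕ) → Role → State
    program       : State → Instruction Message State

------------------------------------------------------------------------
-- Executions.  Each device holds a finite initial part of its infinite sequence
-- of coin tosses.  A device that needs a coin beyond it is `starved`; what
-- happens from then on is not determined by the given coins.

Coins : ℕ → Set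
Coins m = Vec Bool m

module Execution (A : Algorithm) where
  open Algorithm A

  -- The first component is the number of rounds in which the device has been
  -- non-idle, including the current round.
  data Device : Set where
    acting  : ℕ → Action Message State → List Bool → Device
    halted  : ℕ → (output : ℕ) → Device
    starved : Device

  energy : Device → ℕ
  energy (acting e _ _) = e
  energy (halted e _)   = e
  energy starved        = 0

  output : Device → Maybe ℕ
  output (halted _ o) = just o
  output _            = nothing

  cost : Action Message State → ℕ
  cost (listen _)     = 1
  cost (transmit _ _) = 1
  cost (idle _)       = 0

  -- Runs the local computation of a device up to its action in the new round;
  -- e is the energy spent in earlier rounds.
  resume : ℕ → State → List Bool → Device
  resume e q coins with program q
  ... | act a  = acting (e +ℕ cost a) a coins
  ... | halt o = halted e o
  ... | toss k with coins
  ...   | []      = starved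
  ...   | b ∷ bs  = resume e (k b) bs

  sent : Device → Maybe Message
  sent (acting _ (transmit m _) _) = just m
  sent _                           = nothing

  feedback : List Message → Feedback Message
  feedback []          = silence
  feedback (m ∷ [])    = received m
  feedback (_ ∷ _ ∷ _) = collision

  finishRound : Feedback Message → Device → Device
  finishRound f (acting e (listen k)     coins) = resume e (k f) coins
  finishRound f (acting e (transmit _ q) coins) = resume e q coins
  finishRound f (acting e (idle q)       coins) = resume e q coins
  finishRound f d                               = d

  module _ {n : ℕ} (I : Instance n) where
    open Instance I

    role : Fin n → Role
    role v = if does (v ≟ᶠ s) then source else
             if does (v ≟ᶠ t) then sink   else ordinary

    heard : (Fin n → Device) → Fin n → Feedback Message
    heard devices v =
      feedback (mapMaybe (λ u → sent (devices u)) (filter (λ u → T? (adj v u)) (allFin n)))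

    -- The devices in round r (counting from 0), with their actions in that round.
    run : ∀ {m} → Vec (Coins m) n → ℕ → Fin n → Device
    run ω zero    v = resume 0 (start n maxDegree (role v)) (toList (lookup ω v))
    run ω (suc r) v = finishRound (heard (run ω r) v) (run ω r v)

    Determined : ∀ {m} → Vec (Coins m) n → ℕ → Set
    Determined ω r = ∀ v → run ω r v ≢ starved

    EnergyOnInstance≤ : ℕ → Set
    EnergyOnInstance≤ e =
      ∀ {m} (ω : Vec (Coins m) n) r → Determined ω r → ∀ v → energy (run ω r v) ≤ e

    AllOutput : ∀ {m} → ℕ → Vec (Coins m) n → ℕ → Set
    AllOutput c ω r = ∀ v → output (run ω r v) ≡ just c

    allOutput? : ∀ {m} c (ω : Vec (Coins m) n) r → Dec (AllOutput c ω r)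
    allOutput? c ω r = all? λ v → ≡-dec _≟_ (output (run ω r v)) (just c)

vectors : ∀ {a} {A : Set a} → List A → (n : ℕ) → List (Vec A n)
vectors xs zero    = []ᵛ ∷ []
vectors xs (suc n) = cartesianProductWith _∷ᵛ_ xs (vectors xs n)

allCoins : ∀ n m → List (Vec (Coins m) n)
allCoins n m = vectors (vectors (true ∷ false ∷ []) m) n

-- The probability that all devices have halted with output c by round r, without
-- any of them having tossed more than m coins.
probOutputWithin : (A : Algorithm) {n : ℕ} → Instance n → (c m r : ℕ) → ℚ
probOutputWithin A {n} I c m r =
  _/_ (+ length (filter (λ ω → Execution.allOutput? A I c ω r) (allCoins n m)))
      (2 ^ℕ (m *ℕ n)) {{m^n≢0 2 (m *ℕ n)}}

-- The event that all devices eventually halt with output c is the increasing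
-- union, over m and r, of the events above, so its probability is the supremum
-- of theirs.
ProbOutput≥ : (A : Algorithm) {n : ℕ} → Instance n → (c : ℕ) → ℚ → Set
ProbOutput≥ A I c p =
  ∀ ε → 0ℚ <ℚ ε → ∃[ m ] ∃[ r ] (p - ε ≤ℚ probOutputWithin A I c m r)

-- Success probability 1 - O(1 / n ^ k) for some k ≥ 1, uniformly over instances.
ComputesMinCutSizeWHP : Algorithm → Set
ComputesMinCutSizeWHP A =
  ∃[ k ] ∃[ C ] (1 ≤ k × (∀ {n} (I : Instance n) (let open Instance I) c →
    IsMinCutSize s t c →
    ProbOutput≥ A I c (1ℚ - _/_ (+ C) (n ^ℕ k) {{m^n≢0 n k {{nonZeroIndex s}}}})))

-- The energy complexity of A on instances with n vertices is at most e.
EnergyComplexity≤ : Algorithm → (n e : ℕ) → Set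
EnergyComplexity≤ A n e = (I : Instance n) → Execution.EnergyOnInstance≤ A I e

-- The energy complexity is a supremum in ℕ ∪ {∞}; it is at least x exactly when
-- every natural number bounding it is.
EnergyComplexityΩ[n] : Algorithm → Set
EnergyComplexityΩ[n] A =
  ∃[ κ ] (0ℚ <ℚ κ × ∃[ n₀ ] (∀ n → n₀ ≤ n → ∀ e → EnergyComplexity≤ A n e →
    κ * (+ n / 1) ≤ℚ (+ e / 1)))

{-# OPTIONS --safe #-}

-- Let s be adjacent to all of the remaining vertices and t to a random set of
-- them (one vertex always included, for connectedness), so that the minimum cut
-- size is the degree of t.  Whether such a vertex is adjacent to t, its type, can
-- reach the others only through the rounds in which s or t listens.  Take a pair of
-- these vertices and mute it.  If, in every such round, what the pair sends cannot
-- change the feedback (it is silent, or at least two others transmit), then s and t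
-- behave as in the muted run, so the output is the same for all quiet data (type
-- and coins) of the two.  The data of each vertex range independently over the same
-- quiet set; if a of its elements have one type and b the other, the types differ in
-- 2ab cases, and the output is wrong in at least as many of the (a + b)² cases,
-- because it is wrong for all differing types or else for all a² + b² cases of equal
-- types.  A listening round prevents this for at most three of linearly many
-- disjoint pairs, so with o(n) listening rounds the algorithm fails with constant
-- probability.

module Submission where

open import Defs
open import Data.Bool using (Bool; true; false; T; _∧_; not; _xor_; if_then_else_)
open import Data.Bool.Properties using (T?; ∧-identityʳ; ∧-zeroʳ)
open import Data.Empty using (⊥-elim)
open import Data.Fin using (Fin; zero; suc; toℕ; _↑ˡ_; _↑ʳ_)
open import Data.Fin.Patterns using (0F; 1F)
open import Data.Fin.Properties using (toℕ-injective; toℕ-↑ˡ; toℕ-↑ʳ; toℕ<n; ¬∀⟶∃¬; suc-injective)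
  renaming (_≟_ to _≟ᶠ_; all? to allFin?)
open import Data.Fin.Subset using (Subset; _∉_; ∣_∣)
open import Data.Fin.Subset.Properties using (∣p∣≤n)
import Data.Integer as ℤ
import Data.Integer.Properties as ℤ
open import Data.List as List using (List; []; _∷_; _++_; length; map; filter; mapMaybe; allFin; downFrom;
  cartesianProduct; cartesianProductWith)
open import Data.List.Extrema.Nat using (max≤v⁺; v≤max⁺)
open import Data.List.Properties using (mapMaybe-cong; length-tabulate)
open import Data.List.Membership.Propositional using (lose)
open import Data.List.Membership.Propositional.Properties using (∈-allFin)
import Data.List.Relation.Unary.All as All
import Data.List.Relation.Unary.All.Properties as All
import Data.List.Relation.Unary.Any.Properties as Any
open import Data.Maybe using (Maybe; just; nothing; is-just)
import Data.Maybe.Properties as Maybe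
open import Data.Nat using (ℕ; zero; suc; _≤_; _<_; _+_; _*_; _^_; z≤n; s≤s; s≤s⁻¹; _≤?_; _≟_; NonZero)
open import Data.Nat.Properties hiding (_≟_; _≤?_; suc-injective)
open import Data.Nat.Tactic.RingSolver using (solve-∀)
open import Data.Product using (∃-syntax; _×_; _,_; proj₁; proj₂)
open import Data.Rational as ℚ using (ℚ; 0ℚ; 1ℚ; _/_)
import Data.Rational.Properties as ℚ
import Data.Rational.Solver as ℚ
open import Data.Rational.Unnormalised as ℚᵘ using (mkℚᵘ)
import Data.Rational.Unnormalised.Properties as ℚᵘ
open import Data.Sum using (_⊎_; inj₁; inj₂)
open import Data.Unit using (tt)
open import Data.Vec as Vec using (Vec; lookup; toList; _[_]≔_) renaming ([] to []ᵛ; _∷_ to _∷ᵛ_)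
open import Data.Vec.Properties
  using (lookup-map; lookup-replicate; []=⇒lookup; lookup⇒[]=; lookup∘update; lookup∘update′; toList-∷ʳ)
open import Function using (_∘_)
open import Function.Bundles using (mk⇔)
open import Level using (0ℓ)
open import Relation.Binary.Construct.Closure.ReflexiveTransitive using (Star; ε; _◅_; _◅◅_)
open import Relation.Binary.PropositionalEquality
open import Relation.Nullary using (¬_; does; Dec; yes; no)
open import Relation.Nullary.Decidable using (_→-dec_; _×-dec_; does-⇔; dec-true; dec-false)
open import Relation.Unary using (Pred; Decidable)

-- Muting is what makes the quiet data a product. In the real run, whether one vertex of the pair
-- disturbs a hub (s or t) may depend on what the other has sent before, so the two entries would be
-- correlated. In the muted run nobody hears the pair, and each entry is judged without regard to
-- the other. Every pair has its own muted run, but up to the first disturbance it coincides with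
-- the real one; hence the disturbances of all pairs can be charged to listening rounds of a single
-- real run, where the energy bounds their number.
--
-- Probabilities are counts. The type of a vertex is one more coin at the head of its tape, and
-- conditioning on the rest is resampling two entries of a vector.
--
-- Finite tapes require two precautions. The numbers of coins and rounds that make success likely
-- depend on the network, and are raised to values common to all types. The energy is bounded only
-- while no device is starved; since a correct run has no starved device, incorrect runs are set
-- apart in the count of disturbed pairs, and failures enter the final estimate a second time.

private variable
  A B C : Set
  m n K : ℕ

-- Sums

⟦_⟧ : Bool → ℕ
⟦ true ⟧  = 1
⟦ false ⟧ = 0

∑ : List A → (A → ℕ) → ℕ
∑ []       f = 0
∑ (x ∷ xs) f = f x + ∑ xs f

∑-cong : ∀ (xs : List A) {f g} → (∀ x → f x ≡ g x) → ∑ xs f ≡ ∑ xs g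
∑-cong []       f≗g = refl
∑-cong (x ∷ xs) f≗g = cong₂ _+_ (f≗g x) (∑-cong xs f≗g)

∑-mono : ∀ (xs : List A) {f g} → (∀ x → f x ≤ g x) → ∑ xs f ≤ ∑ xs g
∑-mono []       f≤g = z≤n
∑-mono (x ∷ xs) f≤g = +-mono-≤ (f≤g x) (∑-mono xs f≤g)

∑-const : ∀ (xs : List A) k → ∑ xs (λ _ → k) ≡ length xs * k
∑-const []       k = refl
∑-const (x ∷ xs) k = cong (k +_) (∑-const xs k)

∑-zero : ∀ (xs : List A) → ∑ xs (λ _ → 0) ≡ 0
∑-zero xs = trans (∑-const xs 0) (*-zeroʳ (length xs))

∑-+ : ∀ (xs : List A) (f g : A → ℕ) → ∑ xs (λ x → f x + g x) ≡ ∑ xs f + ∑ xs g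
∑-+ []       f g = refl
∑-+ (x ∷ xs) f g = trans (cong (f x + g x +_) (∑-+ xs f g)) (lemma (f x) (g x) _ _)
  where
  lemma : ∀ a b c d → a + b + (c + d) ≡ a + c + (b + d)
  lemma = solve-∀

∑-* : ∀ (xs : List A) k (f : A → ℕ) → ∑ xs (λ x → k * f x) ≡ k * ∑ xs f
∑-* []       k f = sym (*-zeroʳ k)
∑-* (x ∷ xs) k f = trans (cong (k * f x +_) (∑-* xs k f)) (sym (*-distribˡ-+ k (f x) _))

∑-swap : ∀ (xs : List A) (ys : List B) (f : A → B → ℕ) →
         ∑ xs (λ x → ∑ ys (f x)) ≡ ∑ ys (λ y → ∑ xs (λ x → f x y))
∑-swap []       ys f = sym (∑-zero ys)
∑-swap (x ∷ xs) ys f = trans (cong (∑ ys (f x) +_) (∑-swap xs ys f)) (sym (∑-+ ys (f x) _))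

∑-++ : ∀ (xs ys : List A) (f : A → ℕ) → ∑ (xs ++ ys) f ≡ ∑ xs f + ∑ ys f
∑-++ []       ys f = refl
∑-++ (x ∷ xs) ys f = trans (cong (f x +_) (∑-++ xs ys f)) (sym (+-assoc (f x) _ _))

∑-map : ∀ (g : A → B) xs (f : B → ℕ) → ∑ (map g xs) f ≡ ∑ xs (f ∘ g)
∑-map g []       f = refl
∑-map g (x ∷ xs) f = cong (f (g x) +_) (∑-map g xs f)

∑-cartesianProductWith : ∀ (g : A → B → C) xs ys (f : C → ℕ) →
  ∑ (cartesianProductWith g xs ys) f ≡ ∑ xs (λ x → ∑ ys (λ y → f (g x y)))
∑-cartesianProductWith g []       ys f = refl
∑-cartesianProductWith g (x ∷ xs) ys f =
  trans (∑-++ (map (g x) ys) _ f) (cong₂ _+_ (∑-map (g x) ys f) (∑-cartesianProductWith g xs ys f))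

length-filter : ∀ {P : Pred A 0ℓ} (P? : Decidable P) xs →
                length (filter P? xs) ≡ ∑ xs (λ x → ⟦ does (P? x) ⟧)
length-filter P? []       = refl
length-filter P? (x ∷ xs) with does (P? x)
... | true  = cong suc (length-filter P? xs)
... | false = length-filter P? xs

length-mapMaybe-filter : ∀ {P : Pred A 0ℓ} (P? : Decidable P) (g : A → Maybe B) xs →
  length (mapMaybe g (filter P? xs)) ≡ ∑ xs (λ x → ⟦ does (P? x) ∧ is-just (g x) ⟧)
length-mapMaybe-filter P? g []       = refl
length-mapMaybe-filter P? g (x ∷ xs) with does (P? x) | g x in eq
... | false | _       = length-mapMaybe-filter P? g xs
... | true  | just _  rewrite eq = cong suc (length-mapMaybe-filter P? g xs)
... | true  | nothing rewrite eq = length-mapMaybe-filter P? g xs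

∑-tabulate : ∀ (g : Fin n → A) (f : A → ℕ) → ∑ (List.tabulate g) f ≡ ∑ (allFin n) (f ∘ g)
∑-tabulate {zero}  g f = refl
∑-tabulate {suc n} g f = cong (f (g zero) +_)
  (trans (∑-tabulate (g ∘ suc) f) (sym (∑-tabulate suc (f ∘ g))))

∑-allFin-suc : ∀ (f : Fin (suc n) → ℕ) → ∑ (allFin (suc n)) f ≡ f zero + ∑ (allFin n) (f ∘ suc)
∑-allFin-suc f = cong (f zero +_) (∑-tabulate suc f)

∑-allFin-+ : ∀ m {n} (f : Fin (m + n) → ℕ) →
  ∑ (allFin (m + n)) f ≡ ∑ (allFin m) (λ i → f (i ↑ˡ n)) + ∑ (allFin n) (λ i → f (m ↑ʳ i))
∑-allFin-+ zero    f = refl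
∑-allFin-+ (suc m) {n} f = begin
  ∑ (allFin (suc m + n)) f
    ≡⟨ ∑-allFin-suc f ⟩
  f zero + ∑ (allFin (m + n)) (f ∘ suc)
    ≡⟨ cong (f zero +_) (∑-allFin-+ m (f ∘ suc)) ⟩
  f zero + (∑ (allFin m) (λ i → f (suc i ↑ˡ n)) + _)
    ≡⟨ +-assoc (f zero) _ _ ⟨
  f zero + ∑ (allFin m) (λ i → f (suc i ↑ˡ n)) + _
    ≡⟨ cong (_+ ∑ (allFin n) (λ i → f (suc m ↑ʳ i))) (∑-allFin-suc {m} (λ i → f (i ↑ˡ n))) ⟨
  ∑ (allFin (suc m)) (λ i → f (i ↑ˡ n)) + ∑ (allFin n) (λ i → f (suc m ↑ʳ i)) ∎
  where open ≡-Reasoning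

term≤∑ : ∀ (f : Fin n → ℕ) i → f i ≤ ∑ (allFin n) f
term≤∑ f zero    = m≤m+n _ _
term≤∑ {suc n} f (suc i) = begin
  f (suc i)                       ≤⟨ term≤∑ (f ∘ suc) i ⟩
  ∑ (allFin n) (f ∘ suc)          ≤⟨ m≤n+m _ (f zero) ⟩
  f zero + ∑ (allFin n) (f ∘ suc) ≡⟨ ∑-allFin-suc f ⟨
  ∑ (allFin (suc n)) f            ∎
  where open ≤-Reasoning

-- Sums over vectors and resampling of entries

∑-vectors-suc : ∀ (xs : List A) n F → ∑ (vectors xs (suc n)) F ≡
                ∑ xs (λ x → ∑ (vectors xs n) (λ w → F (x ∷ᵛ w)))
∑-vectors-suc xs n F = ∑-cartesianProductWith _∷ᵛ_ xs (vectors xs n) F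

-- Replacing an entry of a uniform vector by a fresh uniform value leaves the vector uniform. This
-- takes the place of conditioning on the other entries: an inequality proved for every fixed rest
-- can be summed and the factor `length xs` cancelled.
∑-resample : ∀ (xs : List A) (i : Fin n) F →
  ∑ (vectors xs n) (λ w → ∑ xs (λ x → F (w [ i ]≔ x))) ≡ length xs * ∑ (vectors xs n) F
∑-resample {n = suc n} xs zero F = begin
  ∑ (vectors xs (suc n)) (λ w → ∑ xs (λ x → F (w [ zero ]≔ x)))
    ≡⟨ ∑-vectors-suc xs n _ ⟩
  ∑ xs (λ _ → ∑ (vectors xs n) (λ w → ∑ xs (λ x → F (x ∷ᵛ w))))
    ≡⟨ ∑-const xs _ ⟩
  length xs * ∑ (vectors xs n) (λ w → ∑ xs (λ x → F (x ∷ᵛ w)))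
    ≡⟨ cong (length xs *_) (∑-swap (vectors xs n) xs (λ w x → F (x ∷ᵛ w))) ⟩
  length xs * ∑ xs (λ x → ∑ (vectors xs n) (λ w → F (x ∷ᵛ w)))
    ≡⟨ cong (length xs *_) (∑-vectors-suc xs n F) ⟨
  length xs * ∑ (vectors xs (suc n)) F ∎
  where open ≡-Reasoning
∑-resample {n = suc n} xs (suc i) F = begin
  ∑ (vectors xs (suc n)) (λ w → ∑ xs (λ x → F (w [ suc i ]≔ x)))
    ≡⟨ ∑-vectors-suc xs n _ ⟩
  ∑ xs (λ y → ∑ (vectors xs n) (λ w → ∑ xs (λ x → F (y ∷ᵛ (w [ i ]≔ x)))))
    ≡⟨ ∑-cong xs (λ y → ∑-resample xs i (λ w → F (y ∷ᵛ w))) ⟩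
  ∑ xs (λ y → length xs * ∑ (vectors xs n) (λ w → F (y ∷ᵛ w)))
    ≡⟨ ∑-* xs (length xs) _ ⟩
  length xs * ∑ xs (λ y → ∑ (vectors xs n) (λ w → F (y ∷ᵛ w)))
    ≡⟨ cong (length xs *_) (∑-vectors-suc xs n F) ⟨
  length xs * ∑ (vectors xs (suc n)) F ∎
  where open ≡-Reasoning

∑-resample₂ : ∀ (xs : List A) (i j : Fin n) F →
  ∑ (vectors xs n) (λ w → ∑ xs (λ x → ∑ xs (λ y → F (w [ i ]≔ x [ j ]≔ y)))) ≡
  length xs * (length xs * ∑ (vectors xs n) F)
∑-resample₂ xs i j F =
  trans (∑-resample xs i (λ w → ∑ xs (λ y → F (w [ j ]≔ y))))
        (cong (length xs *_) (∑-resample xs j F))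

bits : List Bool
bits = true ∷ false ∷ []

coins : ∀ m → List (Coins m)
coins = vectors bits

∑-coins-suc : ∀ m F → ∑ (coins (suc m)) F ≡
              ∑ (coins m) (λ w → F (true ∷ᵛ w)) + ∑ (coins m) (λ w → F (false ∷ᵛ w))
∑-coins-suc m F = trans (∑-vectors-suc bits m F)
  (cong (∑ (coins m) (λ w → F (true ∷ᵛ w)) +_) (+-identityʳ _))

length≡∑1 : ∀ (xs : List A) → length xs ≡ ∑ xs (λ _ → 1)
length≡∑1 xs = sym (trans (∑-const xs 1) (*-identityʳ _))

length-coins-suc : ∀ m → length (coins (suc m)) ≡ 2 * length (coins m)
length-coins-suc m = begin
  length (coins (suc m))    ≡⟨ length≡∑1 (coins (suc m)) ⟩
  ∑ (coins (suc m)) (λ _ → 1)  ≡⟨ ∑-coins-suc m _ ⟩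
  ∑ (coins m) (λ _ → 1) + ∑ (coins m) (λ _ → 1)
    ≡⟨ cong₂ _+_ (length≡∑1 (coins m)) (trans (+-identityʳ _) (length≡∑1 (coins m))) ⟨
  2 * length (coins m) ∎
  where open ≡-Reasoning

-- Every shorter vector has exactly two extensions by a last coin.
∑-coins-init : ∀ m F → ∑ (coins (suc m)) (F ∘ Vec.init) ≡ 2 * ∑ (coins m) F
∑-coins-init zero    F = lemma (F []ᵛ)
  where
  lemma : ∀ a → a + (a + 0) ≡ 2 * (a + 0)
  lemma = solve-∀
∑-coins-init (suc m) F = begin
  ∑ (coins (suc (suc m))) (F ∘ Vec.init)
    ≡⟨ ∑-coins-suc (suc m) _ ⟩
  ∑ (coins (suc m)) (λ w → F (Vec.init (true ∷ᵛ w))) + ∑ (coins (suc m)) (λ w → F (Vec.init (false ∷ᵛ w)))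
    ≡⟨ cong₂ _+_ (∑-coins-init m (λ w → F (true ∷ᵛ w))) (∑-coins-init m (λ w → F (false ∷ᵛ w))) ⟩
  2 * ∑ (coins m) (λ w → F (true ∷ᵛ w)) + 2 * ∑ (coins m) (λ w → F (false ∷ᵛ w))
    ≡⟨ *-distribˡ-+ 2 (∑ (coins m) (λ w → F (true ∷ᵛ w))) _ ⟨
  2 * (∑ (coins m) (λ w → F (true ∷ᵛ w)) + ∑ (coins m) (λ w → F (false ∷ᵛ w)))
    ≡⟨ cong (2 *_) (∑-coins-suc m F) ⟨
  2 * ∑ (coins (suc m)) F ∎
  where open ≡-Reasoning

∑-vectors-map : ∀ (xs : List A) (ys : List B) (g : A → B) k →
  (∀ f → ∑ xs (f ∘ g) ≡ k * ∑ ys f) →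
  ∀ n F → ∑ (vectors xs n) (F ∘ Vec.map g) ≡ k ^ n * ∑ (vectors ys n) F
∑-vectors-map xs ys g k hyp zero    F = sym (*-identityˡ _)
∑-vectors-map xs ys g k hyp (suc n) F = begin
  ∑ (vectors xs (suc n)) (F ∘ Vec.map g)
    ≡⟨ ∑-vectors-suc xs n _ ⟩
  ∑ xs (λ x → ∑ (vectors xs n) (λ w → F (g x ∷ᵛ Vec.map g w)))
    ≡⟨ ∑-cong xs (λ x → ∑-vectors-map xs ys g k hyp n (λ w → F (g x ∷ᵛ w))) ⟩
  ∑ xs (λ x → k ^ n * ∑ (vectors ys n) (λ w → F (g x ∷ᵛ w)))
    ≡⟨ ∑-* xs (k ^ n) _ ⟩
  k ^ n * ∑ xs (λ x → ∑ (vectors ys n) (λ w → F (g x ∷ᵛ w)))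
    ≡⟨ cong (k ^ n *_) (hyp (λ y → ∑ (vectors ys n) (λ w → F (y ∷ᵛ w)))) ⟩
  k ^ n * (k * ∑ ys (λ y → ∑ (vectors ys n) (λ w → F (y ∷ᵛ w))))
    ≡⟨ cong (λ z → k ^ n * (k * z)) (∑-vectors-suc ys n F) ⟨
  k ^ n * (k * ∑ (vectors ys (suc n)) F)
    ≡⟨ lemma (k ^ n) k _ ⟩
  k * k ^ n * ∑ (vectors ys (suc n)) F ∎
  where
  open ≡-Reasoning
  lemma : ∀ a b c → a * (b * c) ≡ b * a * c
  lemma = solve-∀

length-vectors : ∀ (xs : List A) n → length (vectors xs n) ≡ length xs ^ n
length-vectors xs zero    = refl
length-vectors xs (suc n) = begin
  length (vectors xs (suc n))                  ≡⟨ length≡∑1 (vectors xs (suc n)) ⟩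
  ∑ (vectors xs (suc n)) (λ _ → 1)             ≡⟨ ∑-vectors-suc xs n _ ⟩
  ∑ xs (λ _ → ∑ (vectors xs n) (λ _ → 1))      ≡⟨ ∑-const xs _ ⟩
  length xs * ∑ (vectors xs n) (λ _ → 1)       ≡⟨ cong (length xs *_) (length≡∑1 (vectors xs n)) ⟨
  length xs * length (vectors xs n)            ≡⟨ cong (length xs *_) (length-vectors xs n) ⟩
  length xs * length xs ^ n                    ∎
  where open ≡-Reasoning

-- A coin vector of length suc m also encodes a bit together with m coins.
∑-vectors-heads-tails : ∀ m n (F : Vec Bool n → Vec (Coins m) n → ℕ) →
  ∑ (vectors (coins (suc m)) n) (λ w → F (Vec.map Vec.head w) (Vec.map Vec.tail w)) ≡
  ∑ (coins n) (λ x → ∑ (vectors (coins m) n) (F x))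
∑-vectors-heads-tails m zero    F = cong (_+ 0) (sym (+-identityʳ _))
∑-vectors-heads-tails m (suc n) F = begin
  ∑ (vectors (coins (suc m)) (suc n)) (λ w → F (Vec.map Vec.head w) (Vec.map Vec.tail w))
    ≡⟨ ∑-vectors-suc (coins (suc m)) n _ ⟩
  ∑ (coins (suc m)) (λ y → ∑ (vectors (coins (suc m)) n)
    (λ w → F (Vec.head y ∷ᵛ Vec.map Vec.head w) (Vec.tail y ∷ᵛ Vec.map Vec.tail w)))
    ≡⟨ ∑-cong (coins (suc m)) (λ y → ∑-vectors-heads-tails m n (λ x ω → F (Vec.head y ∷ᵛ x) (Vec.tail y ∷ᵛ ω))) ⟩
  ∑ (coins (suc m)) (λ y → ∑ (coins n) λ x → ∑ (vectors (coins m) n) λ ω → F (Vec.head y ∷ᵛ x) (Vec.tail y ∷ᵛ ω))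
    ≡⟨ ∑-vectors-suc bits m _ ⟩
  ∑ bits (λ b → ∑ (coins m) λ c → ∑ (coins n) λ x → ∑ (vectors (coins m) n) λ ω → F (b ∷ᵛ x) (c ∷ᵛ ω))
    ≡⟨ ∑-cong bits (λ b → ∑-swap (coins m) (coins n)
         (λ c x → ∑ (vectors (coins m) n) λ ω → F (b ∷ᵛ x) (c ∷ᵛ ω))) ⟩
  ∑ bits (λ b → ∑ (coins n) λ x → ∑ (coins m) λ c → ∑ (vectors (coins m) n) λ ω → F (b ∷ᵛ x) (c ∷ᵛ ω))
    ≡⟨ ∑-cong bits (λ b → ∑-cong (coins n) λ x → sym (∑-vectors-suc (coins m) n (F (b ∷ᵛ x)))) ⟩
  ∑ bits (λ b → ∑ (coins n) λ x → ∑ (vectors (coins m) (suc n)) (F (b ∷ᵛ x)))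
    ≡⟨ ∑-vectors-suc bits n _ ⟨
  ∑ (coins (suc n)) (λ x → ∑ (vectors (coins m) (suc n)) (F x)) ∎
  where open ≡-Reasoning

-- The weight `N` will be the indicator of the quiet data. As `f` sees only the types, the double
-- sum collapses to a quadratic form in the numbers `a` and `b` of quiet data of the two types.
∑∑-by-heads : ∀ m (N : Coins (suc m) → ℕ) (f : Bool → Bool → ℕ) →
  let a = ∑ (coins m) (λ w → N (true ∷ᵛ w))
      b = ∑ (coins m) (λ w → N (false ∷ᵛ w))
  in ∑ (coins (suc m)) (λ y → ∑ (coins (suc m)) (λ z → N y * (N z * f (Vec.head y) (Vec.head z)))) ≡
     a * (a * f true true + b * f true false) + b * (a * f false true + b * f false false)
∑∑-by-heads m N f = trans (∑-coins-suc m _) (cong₂ _+_ (outer true) (outer false))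
  where
  open ≡-Reasoning
  block : Bool → ℕ
  block b = ∑ (coins m) (λ w → N (b ∷ᵛ w))

  *-∑-* : ∀ b k → ∑ (coins m) (λ w → N (b ∷ᵛ w) * k) ≡ block b * k
  *-∑-* b k = trans (∑-cong (coins m) (λ w → *-comm _ k))
                    (trans (∑-* (coins m) k _) (*-comm k _))

  inner : ∀ c → ∑ (coins (suc m)) (λ z → N z * f c (Vec.head z)) ≡
                block true * f c true + block false * f c false
  inner c = trans (∑-coins-suc m _) (cong₂ _+_ (*-∑-* true _) (*-∑-* false _))

  outer : ∀ c → ∑ (coins m) (λ w → ∑ (coins (suc m)) (λ z → N (c ∷ᵛ w) * (N z * f c (Vec.head z)))) ≡
                block c * (block true * f c true + block false * f c false)
  outer c = trans (∑-cong (coins m) (λ w → trans (∑-* (coins (suc m)) (N (c ∷ᵛ w)) _)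
                                                 (cong (N (c ∷ᵛ w) *_) (inner c))))
                  (*-∑-* c _)

-- Nonnegativity of the square of the difference; lowering both arguments together avoids
-- subtraction.
2mn≤m²+n² : ∀ m n → m * n + n * m ≤ m * m + n * n
2mn≤m²+n² zero    n       = ≤-trans (≤-reflexive (*-zeroʳ n)) z≤n
2mn≤m²+n² (suc m) zero    = ≤-trans (≤-reflexive (trans (+-identityʳ _) (*-zeroʳ m))) z≤n
2mn≤m²+n² (suc m) (suc n) = begin
  suc m * suc n + suc n * suc m       ≡⟨ lhs m n ⟩
  m * n + n * m + (2 + 2 * m + 2 * n) ≤⟨ +-monoˡ-≤ _ (2mn≤m²+n² m n) ⟩
  m * m + n * n + (2 + 2 * m + 2 * n) ≡⟨ rhs m n ⟩
  suc m * suc m + suc n * suc n       ∎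
  where
  open ≤-Reasoning
  lhs : ∀ m n → suc m * suc n + suc n * suc m ≡ m * n + n * m + (2 + 2 * m + 2 * n)
  lhs = solve-∀
  rhs : ∀ m n → m * m + n * n + (2 + 2 * m + 2 * n) ≡ suc m * suc m + suc n * suc n
  rhs = solve-∀

2*∑∑-xor : ∀ m → 2 * ∑ (coins (suc m)) (λ y → ∑ (coins (suc m)) (λ z → ⟦ Vec.head y xor Vec.head z ⟧)) ≡
           length (coins (suc m)) * length (coins (suc m))
2*∑∑-xor m = begin
  2 * ∑ (coins (suc m)) (λ y → ∑ (coins (suc m)) (λ z → ⟦ Vec.head y xor Vec.head z ⟧))
    ≡⟨ cong (2 *_) (∑-cong (coins (suc m)) λ y → ∑-cong (coins (suc m)) λ z →
         sym (trans (*-identityˡ _) (*-identityˡ _))) ⟩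
  2 * ∑ (coins (suc m)) (λ y → ∑ (coins (suc m)) (λ z → 1 * (1 * ⟦ Vec.head y xor Vec.head z ⟧)))
    ≡⟨ cong (2 *_) (∑∑-by-heads m (λ _ → 1) (λ b c → ⟦ b xor c ⟧)) ⟩
  2 * (h * (h * 0 + h * 1) + h * (h * 1 + h * 0))
    ≡⟨ lemma h ⟩
  (2 * h) * (2 * h)
    ≡⟨ cong (λ z → (2 * z) * (2 * z)) (length≡∑1 (coins m)) ⟨
  (2 * length (coins m)) * (2 * length (coins m))
    ≡⟨ cong₂ _*_ (length-coins-suc m) (length-coins-suc m) ⟨
  length (coins (suc m)) * length (coins (suc m)) ∎
  where
  open ≡-Reasoning
  h : ℕ
  h = ∑ (coins m) (λ _ → 1)
  lemma : ∀ h → 2 * (h * (h * 0 + h * 1) + h * (h * 1 + h * 0)) ≡ (2 * h) * (2 * h)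
  lemma = solve-∀

-- The networks

-- Vertex 0 is s, vertex 1 is t, and vertex 2 + i is adjacent to s, and to t when
-- the i-th bit is set.
link : Vec Bool K → Fin (2 + K) → Fin (2 + K) → Bool
link x 0F            0F            = false
link x 0F            1F            = false
link x 0F            (suc (suc i)) = true
link x 1F            0F            = false
link x 1F            1F            = false
link x 1F            (suc (suc i)) = lookup x i
link x (suc (suc i)) 0F            = true
link x (suc (suc i)) 1F            = lookup x i
link x (suc (suc i)) (suc (suc j)) = false

link-symmetric : ∀ (x : Vec Bool K) u v → link x u v ≡ link x v u
link-symmetric x 0F            0F            = refl
link-symmetric x 0F            1F            = refl
link-symmetric x 0F            (suc (suc i)) = refl
link-symmetric x 1F            0F            = refl
link-symmetric x 1F            1F            = refl
link-symmetric x 1F            (suc (suc i)) = refl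
link-symmetric x (suc (suc i)) 0F            = refl
link-symmetric x (suc (suc i)) 1F            = refl
link-symmetric x (suc (suc i)) (suc (suc j)) = refl

link-loopless : ∀ (x : Vec Bool K) v → link x v v ≡ false
link-loopless x 0F            = refl
link-loopless x 1F            = refl
link-loopless x (suc (suc i)) = refl

linkGraph : Vec Bool K → Graph (2 + K)
linkGraph x = record { adj = link x ; symmetric = link-symmetric x ; loopless = link-loopless x }

∣tabulate-true∣ : ∀ k → ∣ Vec.tabulate {n = k} (λ _ → true) ∣ ≡ k
∣tabulate-true∣ zero    = refl
∣tabulate-true∣ (suc k) = cong suc (∣tabulate-true∣ k)

∣tabulate-false∣ : ∀ k → ∣ Vec.tabulate {n = k} (λ _ → false) ∣ ≡ 0
∣tabulate-false∣ zero    = refl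
∣tabulate-false∣ (suc k) = ∣tabulate-false∣ k

maxDegree-≡ : ∀ {n} (G : Graph n) k v → (∀ u → Graph.degree G u ≤ k) → k ≤ Graph.degree G v →
              Graph.maxDegree G ≡ k
maxDegree-≡ {n} G k v degree≤k k≤degree = ≤-antisym
  (max≤v⁺ z≤n (All.map⁺ (All.universal degree≤k (allFin n))))
  (v≤max⁺ 0 (map (Graph.degree G) (allFin n)) (inj₂ (Any.map⁺ (lose (∈-allFin v) k≤degree))))

linkGraph-bipartite : ∀ (x : Vec Bool K) → Graph.Bipartite (linkGraph x)
linkGraph-bipartite {K} x = side , alternates
  where
  side : Fin (2 + K) → Bool
  side 0F            = true
  side 1F            = true
  side (suc (suc i)) = false
  alternates : ∀ u v → T (link x u v) → side u ≢ side v
  alternates 0F            (suc (suc i)) _ ()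
  alternates 1F            (suc (suc i)) _ ()
  alternates (suc (suc i)) 0F            _ ()
  alternates (suc (suc i)) 1F            _ ()

linkGraph-connected : ∀ (x : Vec Bool K) → Graph.Connected (linkGraph (true ∷ᵛ x))
linkGraph-connected {K} x u v = toSource u ◅◅ fromSource v
  where
  open Graph (linkGraph (true ∷ᵛ x)) using (Adj)
  toSource : ∀ v → Star Adj v 0F
  toSource 0F            = ε
  -- Vertex 2, whose bit is fixed to `true`, is the only certain link between t and the rest. The
  -- omitted adjacency proofs lie in types that reduce to the unit type.
  toSource 1F            = _◅_ {j = suc (suc 0F)} _ (_ ◅ ε)
  toSource (suc (suc i)) = _ ◅ ε
  fromSource : ∀ v → Star Adj 0F v
  fromSource 0F            = ε
  fromSource 1F            = _◅_ {j = suc (suc 0F)} _ (_ ◅ ε)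
  fromSource (suc (suc i)) = _ ◅ ε

-- Minimum cuts

bitSum : Vec Bool K → ℕ
bitSum x = Vec.sum (Vec.map ⟦_⟧ x)

∑-lookup : ∀ (x : Vec Bool K) → ∑ (allFin K) (λ i → ⟦ lookup x i ⟧) ≡ bitSum x
∑-lookup []ᵛ      = refl
∑-lookup (b ∷ᵛ x) = trans (∑-allFin-suc (λ i → ⟦ lookup (b ∷ᵛ x) i ⟧)) (cong (⟦ b ⟧ +_) (∑-lookup x))

cutSize≡∑ : ∀ {n} (G : Graph n) X → Graph.cutSize G X ≡
  ∑ (allFin n) (λ u → ∑ (allFin n) (λ v → ⟦ lookup X u ∧ not (lookup X v) ∧ Graph.adj G u v ⟧))
cutSize≡∑ {n} G X = trans (length-filter _ (cartesianProduct (allFin n) (allFin n)))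
                          (∑-cartesianProductWith _,_ (allFin n) (allFin n) _)

∑-allFin-2+ : ∀ (f : Fin (2 + K) → ℕ) →
  ∑ (allFin (2 + K)) f ≡ f 0F + (f 1F + ∑ (allFin K) (λ i → f (suc (suc i))))
∑-allFin-2+ f = trans (∑-allFin-suc f) (cong (f 0F +_) (∑-allFin-suc (f ∘ suc)))

module _ (x : Vec Bool K) where
  open Graph (linkGraph x) using (cutSize; IsMinCutSize)

  private
    crossing : Subset (2 + K) → Fin (2 + K) → Fin (2 + K) → Bool
    crossing X u v = lookup X u ∧ not (lookup X v) ∧ link x u v

  allButSink : Subset (2 + K)
  allButSink = true ∷ᵛ false ∷ᵛ Vec.replicate K true

  cutSize-allButSink : cutSize allButSink ≡ bitSum x
  cutSize-allButSink = begin
    cutSize allButSink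
      ≡⟨ cutSize≡∑ (linkGraph x) allButSink ⟩
    ∑ (allFin (2 + K)) (λ u → ∑ (allFin (2 + K)) (λ v → ⟦ crossing allButSink u v ⟧))
      ≡⟨ ∑-allFin-2+ (λ u → ∑ (allFin (2 + K)) (λ v → ⟦ crossing allButSink u v ⟧)) ⟩
    ∑ (allFin (2 + K)) (λ v → ⟦ crossing allButSink 0F v ⟧) +
      (∑ (allFin (2 + K)) (λ v → 0) +
       ∑ (allFin K) (λ i → ∑ (allFin (2 + K)) (λ v → ⟦ crossing allButSink (suc (suc i)) v ⟧)))
      ≡⟨ cong₂ _+_ row₀ (cong₂ _+_ (∑-zero (allFin (2 + K))) (∑-cong (allFin K) row)) ⟩
    ∑ (allFin K) (λ i → ⟦ lookup x i ⟧)
      ≡⟨ ∑-lookup x ⟩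
    bitSum x ∎
    where
    open ≡-Reasoning
    row₀ : ∑ (allFin (2 + K)) (λ v → ⟦ crossing allButSink 0F v ⟧) ≡ 0
    row₀ = trans (∑-allFin-2+ (λ v → ⟦ crossing allButSink 0F v ⟧)) (trans
      (∑-cong (allFin K) (λ i → cong (λ b → ⟦ not b ∧ true ⟧) (lookup-replicate i true)))
      (∑-zero (allFin K)))
    row : ∀ i → ∑ (allFin (2 + K)) (λ v → ⟦ crossing allButSink (suc (suc i)) v ⟧) ≡ ⟦ lookup x i ⟧
    row i rewrite lookup-replicate i true = trans
      (∑-allFin-2+ (λ v → ⟦ not (lookup allButSink v) ∧ link x (suc (suc i)) v ⟧))
      (trans (cong (⟦ lookup x i ⟧ +_)
        (trans (∑-cong (allFin K) (λ j → cong ⟦_⟧ (∧-zeroʳ (not (lookup (Vec.replicate K true) j)))))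
               (∑-zero (allFin K))))
        (+-identityʳ _))

  -- Each neighbour `i` of t lies on a path s, `i`, t. Whichever side `i` is on, one of the two
  -- edges of this path crosses the cut, and paths through different neighbours share no edge.
  bitSum≤cutSize : ∀ X → lookup X 0F ≡ true → lookup X 1F ≡ false → bitSum x ≤ cutSize X
  bitSum≤cutSize (true ∷ᵛ false ∷ᵛ X) refl refl = begin
    bitSum x
      ≡⟨ ∑-lookup x ⟨
    ∑ (allFin K) (λ i → ⟦ lookup x i ⟧)
      ≤⟨ ∑-mono (allFin K) split ⟩
    ∑ (allFin K) (λ i → ⟦ crossing Y 0F (suc (suc i)) ⟧ + ⟦ crossing Y (suc (suc i)) 1F ⟧)
      ≡⟨ ∑-+ (allFin K) _ _ ⟩
    ∑ (allFin K) (λ i → ⟦ crossing Y 0F (suc (suc i)) ⟧) + ∑ (allFin K) (λ i → ⟦ crossing Y (suc (suc i)) 1F ⟧)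
      ≤⟨ +-mono-≤
           (≤-reflexive (sym (∑-allFin-2+ (λ v → ⟦ crossing Y 0F v ⟧))))
           (≤-trans (∑-mono (allFin K) (λ i → term≤∑ (λ v → ⟦ crossing Y (suc (suc i)) v ⟧) 1F)) (m≤n+m _ _)) ⟩
    ∑ (allFin (2 + K)) (λ v → ⟦ crossing Y 0F v ⟧) +
      (∑ (allFin (2 + K)) (λ v → ⟦ crossing Y 1F v ⟧) +
       ∑ (allFin K) (λ i → ∑ (allFin (2 + K)) (λ v → ⟦ crossing Y (suc (suc i)) v ⟧)))
      ≡⟨ ∑-allFin-2+ (λ u → ∑ (allFin (2 + K)) (λ v → ⟦ crossing Y u v ⟧)) ⟨
    ∑ (allFin (2 + K)) (λ u → ∑ (allFin (2 + K)) (λ v → ⟦ crossing Y u v ⟧))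
      ≡⟨ cutSize≡∑ (linkGraph x) Y ⟨
    cutSize Y ∎
    where
    open ≤-Reasoning
    Y : Subset (2 + K)
    Y = true ∷ᵛ false ∷ᵛ X
    split : ∀ i → ⟦ lookup x i ⟧ ≤ ⟦ crossing Y 0F (suc (suc i)) ⟧ + ⟦ crossing Y (suc (suc i)) 1F ⟧
    split i with lookup X i
    ... | true  = ≤-refl
    ... | false with lookup x i
    ...   | true  = ≤-refl
    ...   | false = z≤n

  isMinCutSize-bitSum : IsMinCutSize 0F 1F (bitSum x)
  isMinCutSize-bitSum =
      (allButSink , lookup⇒[]= 0F allButSink refl , (λ ()) ∘ []=⇒lookup , cutSize-allButSink)
    , λ X s∈X t∉X → bitSum≤cutSize X ([]=⇒lookup s∈X) (outside X t∉X)
    where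
    outside : ∀ X → 1F ∉ X → lookup X 1F ≡ false
    outside (_ ∷ᵛ true  ∷ᵛ X) t∉X = ⊥-elim (t∉X (lookup⇒[]= 1F (_ ∷ᵛ true ∷ᵛ X) refl))
    outside (_ ∷ᵛ false ∷ᵛ X) t∉X = refl

-- Planarity

private
  ℕ→ℚ : ℕ → ℚ
  ℕ→ℚ i = ℤ.+ i / 1

  ℕ→ℚ-injective : ∀ i j → ℕ→ℚ i ≡ ℕ→ℚ j → i ≡ j
  ℕ→ℚ-injective i j eq with ℚ.fromℚᵘ-injective {ℚᵘ.mkℚᵘ (ℤ.+ i) 0} {ℚᵘ.mkℚᵘ (ℤ.+ j) 0} eq
  ... | ℚᵘ.*≡* eq′ = ℤ.+-injective (ℤ.*-cancelʳ-≡ (ℤ.+ i) (ℤ.+ j) (ℤ.+ 1) eq′)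

  neg-involutive : ∀ q → ℚ.- (ℚ.- q) ≡ q
  neg-involutive = solve 1 (λ q → :- (:- q) := q) refl
    where open ℚ.+-*-Solver

  θ≡1-[1-θ] : ∀ θ → θ ≡ 1ℚ ℚ.- (1ℚ ℚ.- θ)
  θ≡1-[1-θ] = solve 1 (λ θ → θ := con 1ℚ :- (con 1ℚ :- θ)) refl
    where open ℚ.+-*-Solver

  abscissa : ∀ θ k → (1ℚ ℚ.- θ) ℚ.* 0ℚ ℚ.+ θ ℚ.* k ≡ θ ℚ.* k
  abscissa = solve 2 (λ θ k → (con 1ℚ :- θ) :* con 0ℚ :+ θ :* k := θ :* k) refl
    where open ℚ.+-*-Solver

  1-θ≡0⇒θ≡1 : ∀ θ → 1ℚ ℚ.- θ ≡ 0ℚ → θ ≡ 1ℚ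
  1-θ≡0⇒θ≡1 θ eq = trans (θ≡1-[1-θ] θ) (cong (λ r → 1ℚ ℚ.- r) eq)

  0≤1-θ : ∀ {θ} → θ ℚ.≤ 1ℚ → 0ℚ ℚ.≤ 1ℚ ℚ.- θ
  0≤1-θ {θ} θ≤1 = subst (ℚ._≤ 1ℚ ℚ.- θ) (ℚ.+-inverseʳ θ) (ℚ.+-monoˡ-≤ (ℚ.- θ) θ≤1)

  *-cancelˡ-≡-≥0 : ∀ {θ p q} → 0ℚ ℚ.≤ θ → θ ≢ 0ℚ → θ ℚ.* p ≡ θ ℚ.* q → p ≡ q
  *-cancelˡ-≡-≥0 {θ} {p} {q} 0≤θ θ≢0 eq = ℚ.≤-antisym
    (ℚ.*-cancelˡ-≤-pos θ {{θ>0}} (ℚ.≤-reflexive eq))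
    (ℚ.*-cancelˡ-≤-pos θ {{θ>0}} (ℚ.≤-reflexive (sym eq)))
    where
    θ>0 : ℚ.Positive θ
    θ>0 = ℚ.nonNeg∧nonZero⇒pos θ {{ℚ.nonNegative 0≤θ}} {{ℚ.≢-nonZero θ≢0}}

  -- Parametrizes the segment from (0 , 1) to (i , 0); the one from (0 , -1) is
  -- its reflection.
  data Spoke (i : ℕ) (a b : ℚ) : Set where
    along : ∀ θ → 0ℚ ℚ.≤ θ → θ ℚ.≤ 1ℚ → a ≡ θ ℚ.* ℕ→ℚ i → b ≡ 1ℚ ℚ.- θ → Spoke i a b

  upper : ∀ i a b → OnSegment (0ℚ , 1ℚ) (ℕ→ℚ i , 0ℚ) (a , b) → Spoke i a b
  upper i a b (θ , 0≤θ , θ≤1 , a≡ , b≡) =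
    along θ 0≤θ θ≤1 (trans a≡ (abscissa θ (ℕ→ℚ i))) (trans b≡ (ordinate θ))
    where
    open ℚ.+-*-Solver
    ordinate : ∀ θ → (1ℚ ℚ.- θ) ℚ.* 1ℚ ℚ.+ θ ℚ.* 0ℚ ≡ 1ℚ ℚ.- θ
    ordinate = solve 1 (λ θ → (con 1ℚ :- θ) :* con 1ℚ :+ θ :* con 0ℚ := con 1ℚ :- θ) refl

  lower : ∀ i a b → OnSegment (0ℚ , ℚ.- 1ℚ) (ℕ→ℚ i , 0ℚ) (a , b) → Spoke i a (ℚ.- b)
  lower i a b (θ , 0≤θ , θ≤1 , a≡ , b≡) =
    along θ 0≤θ θ≤1 (trans a≡ (abscissa θ (ℕ→ℚ i))) (trans (cong ℚ.-_ b≡) (ordinate θ))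
    where
    open ℚ.+-*-Solver
    ordinate : ∀ θ → ℚ.- ((1ℚ ℚ.- θ) ℚ.* (ℚ.- 1ℚ) ℚ.+ θ ℚ.* 0ℚ) ≡ 1ℚ ℚ.- θ
    ordinate = solve 1 (λ θ → :- ((con 1ℚ :- θ) :* (:- con 1ℚ) :+ θ :* con 0ℚ) := con 1ℚ :- θ) refl

  spoke-height : ∀ {i a b} → Spoke i a b → 0ℚ ℚ.≤ b
  spoke-height (along θ _ θ≤1 _ refl) = 0≤1-θ θ≤1

  spoke-foot : ∀ {i a b} → Spoke i a b → b ≡ 0ℚ → a ≡ ℕ→ℚ i
  spoke-foot {i} (along θ _ _ refl b≡) b≡0 =
    trans (cong (ℚ._* ℕ→ℚ i) (1-θ≡0⇒θ≡1 θ (trans (sym b≡) b≡0))) (ℚ.*-identityˡ _)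

  -- The height determines the parameter, so both spokes have the same θ. Away from the apex θ is
  -- nonzero and cancels from the abscissae.
  spokes-meet : ∀ {i j a b} → Spoke i a b → Spoke j a b → ¬ (a ≡ 0ℚ × b ≡ 1ℚ) → i ≡ j
  spokes-meet {i} {j} (along θ 0≤θ _ refl b≡) (along φ _ _ a≡ b≡′) ≢apex =
    ℕ→ℚ-injective i j (*-cancelˡ-≡-≥0 0≤θ θ≢0 (trans a≡ (cong (ℚ._* ℕ→ℚ j) (sym θ≡φ))))
    where
    θ≡φ : θ ≡ φ
    θ≡φ = trans (θ≡1-[1-θ] θ) (trans (cong (λ r → 1ℚ ℚ.- r) (trans (sym b≡) b≡′)) (sym (θ≡1-[1-θ] φ)))
    θ≢0 : θ ≢ 0ℚ
    θ≢0 refl = ≢apex (ℚ.*-zeroˡ (ℕ→ℚ i) , b≡)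

  -1≱0 : ¬ (0ℚ ℚ.≤ ℚ.- 1ℚ)
  -1≱0 (ℚ.*≤* ())

  -- One spoke stays in the upper half plane and the other in the lower one.
  opposite-spokes : ∀ {i j a b} → Spoke i a b → Spoke j a (ℚ.- b) → b ≡ 0ℚ
  opposite-spokes {b = b} P Q = ℚ.≤-antisym
    (subst (ℚ._≤ 0ℚ) (neg-involutive b) (ℚ.neg-antimono-≤ (spoke-height Q)))
    (spoke-height P)

-- A straight-line drawing with s and t on the vertical axis, above and below the horizontal axis
-- that carries all other vertices. As s and t are not adjacent, the first of these can sit at the
-- origin, between them.
linkGraph-planar : ∀ (x : Vec Bool K) → Planar (linkGraph x)
linkGraph-planar {K} x = record
  { position           = position
  ; corners            = λ _ _ → []
  ; positions-distinct = distinct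
  ; edges-simple       = λ u v (u<v , _) eq → <-irrefl (cong toℕ (distinct u v eq)) u<v
  ; avoids-vertices    = avoids-vertices
  ; avoids-edges       = avoids-edges
  }
  where
  position : Fin (2 + K) → Point
  position 0F            = 0ℚ , 1ℚ
  position 1F            = 0ℚ , ℚ.- 1ℚ
  position (suc (suc i)) = ℕ→ℚ (toℕ i) , 0ℚ

  distinct : ∀ u v → position u ≡ position v → u ≡ v
  distinct 0F            0F            _  = refl
  distinct 1F            1F            _  = refl
  distinct (suc (suc i)) (suc (suc j)) eq =
    cong {A = Fin K} (λ k → suc (suc k)) (toℕ-injective (ℕ→ℚ-injective (toℕ i) (toℕ j) (cong proj₁ eq)))
  distinct 0F            1F            eq with () ← cong proj₂ eq
  distinct 0F            (suc (suc _)) eq with () ← cong proj₂ eq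
  distinct 1F            0F            eq with () ← cong proj₂ eq
  distinct 1F            (suc (suc _)) eq with () ← cong proj₂ eq
  distinct (suc (suc _)) 0F            eq with () ← cong proj₂ eq
  distinct (suc (suc _)) 1F            eq with () ← cong proj₂ eq

  Edge : Fin (2 + K) → Fin (2 + K) → Set
  Edge u v = toℕ u < toℕ v × T (link x u v)

  OnEdge : Fin (2 + K) → Fin (2 + K) → Point → Set
  OnEdge u v = OnSegment (position u) (position v)

  Interior : Fin (2 + K) → Fin (2 + K) → Point → Set
  Interior u v p = OnEdge u v p × p ≢ position u × p ≢ position v

  avoids-vertices : ∀ u v → Edge u v → ∀ p → Interior u v p → ∀ w → p ≢ position w
  avoids-vertices 0F (suc (suc i)) _ (a , b) (on , ≢u , ≢v) 0F            eq   = ≢u eq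
  avoids-vertices 0F (suc (suc i)) _ (a , b) (on , ≢u , ≢v) 1F            refl = -1≱0 (spoke-height (upper (toℕ i) 0ℚ (ℚ.- 1ℚ) on))
  avoids-vertices 0F (suc (suc i)) _ (a , b) (on , ≢u , ≢v) (suc (suc _)) refl =
    ≢v (cong (_, 0ℚ) (spoke-foot (upper (toℕ i) a 0ℚ on) refl))
  avoids-vertices 1F (suc (suc i)) _ (a , b) (on , ≢u , ≢v) 0F            refl = -1≱0 (spoke-height (lower (toℕ i) 0ℚ 1ℚ on))
  avoids-vertices 1F (suc (suc i)) _ (a , b) (on , ≢u , ≢v) 1F            eq   = ≢u eq
  avoids-vertices 1F (suc (suc i)) _ (a , b) (on , ≢u , ≢v) (suc (suc _)) refl =
    ≢v (cong (_, 0ℚ) (spoke-foot (lower (toℕ i) a 0ℚ on) refl))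
  avoids-vertices 1F            1F (_ , ())
  avoids-vertices (suc (suc i)) 1F (s≤s () , _)
  avoids-vertices (suc (suc i)) (suc (suc j)) (_ , ())

  avoids-edges : ∀ u v u′ v′ → Edge u v → Edge u′ v′ → ∀ p →
                 Interior u v p → OnEdge u′ v′ p → u ≡ u′ × v ≡ v′
  avoids-edges 0F (suc (suc i)) 0F (suc (suc j)) _ _ (a , b) (on , ≢u , ≢v) on′ =
    refl , cong {A = Fin K} (λ k → suc (suc k)) (toℕ-injective (spokes-meet (upper (toℕ i) a b on) (upper (toℕ j) a b on′)
      λ { (refl , refl) → ≢u refl }))
  avoids-edges 1F (suc (suc i)) 1F (suc (suc j)) _ _ (a , b) (on , ≢u , ≢v) on′ =
    refl , cong {A = Fin K} (λ k → suc (suc k)) (toℕ-injective (spokes-meet (lower (toℕ i) a b on) (lower (toℕ j) a b on′)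
      λ (a≡0 , -b≡1) → ≢u (cong₂ _,_ a≡0 (trans (sym (neg-involutive b)) (cong ℚ.-_ -b≡1)))))
  avoids-edges 0F (suc (suc i)) 1F (suc (suc j)) _ _ (a , b) (on , ≢u , ≢v) on′ =
    ⊥-elim (≢v (cong₂ _,_ (spoke-foot (upper (toℕ i) a b on) b≡0) b≡0))
    where
    b≡0 : b ≡ 0ℚ
    b≡0 = opposite-spokes (upper (toℕ i) a b on) (lower (toℕ j) a b on′)
  avoids-edges 1F (suc (suc i)) 0F (suc (suc j)) _ _ (a , b) (on , ≢u , ≢v) on′ =
    ⊥-elim (≢v (cong₂ _,_ (spoke-foot (lower (toℕ i) a b on) (cong ℚ.-_ b≡0)) b≡0))
    where
    b≡0 : b ≡ 0ℚ
    b≡0 = opposite-spokes (upper (toℕ j) a b on′) (lower (toℕ i) a b on)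
  avoids-edges 1F            1F            _ _ (_ , ())
  avoids-edges (suc (suc i)) 1F            _ _ (s≤s () , _)
  avoids-edges (suc (suc i)) (suc (suc j)) _ _ (_ , ())
  avoids-edges 0F (suc (suc i)) 1F            1F            _ (_ , ())
  avoids-edges 0F (suc (suc i)) (suc (suc j)) 1F            _ (s≤s () , _)
  avoids-edges 0F (suc (suc i)) (suc (suc j)) (suc (suc k)) _ (_ , ())
  avoids-edges 1F (suc (suc i)) 1F            1F            _ (_ , ())
  avoids-edges 1F (suc (suc i)) (suc (suc j)) 1F            _ (s≤s () , _)
  avoids-edges 1F (suc (suc i)) (suc (suc j)) (suc (suc k)) _ (_ , ())

linkInstance : Vec Bool K → Instance (3 + K)
linkInstance x = record
  { graph     = linkGraph (true ∷ᵛ x)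
  ; s         = 0F
  ; t         = 1F
  ; s≢t       = λ ()
  ; connected = linkGraph-connected x
  ; planar    = linkGraph-planar (true ∷ᵛ x)
  ; bipartite = linkGraph-bipartite (true ∷ᵛ x)
  }

-- The degree of s is maximal whatever the bits are, so the known Δ reveals nothing about the types
-- and all these networks share their start states. The bound `1 ≤ K` leaves room for the degree 2
-- of a common neighbour of s and t.
linkInstance-maxDegree : ∀ (x : Vec Bool K) → 1 ≤ K → Graph.maxDegree (Instance.graph (linkInstance x)) ≡ suc K
linkInstance-maxDegree {K} x 1≤K = maxDegree-≡ (Instance.graph (linkInstance x)) (suc K) 0F
  degree≤ (≤-reflexive (sym (∣tabulate-true∣ (suc K))))
  where
  degree≤ : ∀ v → Graph.degree (Instance.graph (linkInstance x)) v ≤ suc K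
  degree≤ 0F = ≤-reflexive (∣tabulate-true∣ (suc K))
  degree≤ 1F = ∣p∣≤n (Vec.tabulate (lookup (true ∷ᵛ x)))
  degree≤ (suc (suc i)) with lookup (true ∷ᵛ x) i
  ... | true  = subst (_≤ suc K) (cong (2 +_) (sym (∣tabulate-false∣ (suc K)))) (s≤s 1≤K)
  ... | false = subst (_≤ suc K) (cong suc (sym (∣tabulate-false∣ (suc K)))) (s≤s z≤n)

-- Executions

¬→⇒ : ∀ {P Q : Set} → Dec P → ¬ (P → Q) → P × ¬ Q
¬→⇒ (yes p) ¬pq = p , λ q → ¬pq (λ _ → q)
¬→⇒ (no ¬p) ¬pq = ⊥-elim (¬pq (λ p → ⊥-elim (¬p p)))

gate : Bool → Maybe A → Maybe A
gate b x = if b then x else nothing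

-- With the test moved into the message function, two inboxes can be compared vertex by vertex even
-- if their filters differ.
mapMaybe-filter : ∀ (p : A → Bool) (f : A → Maybe B) xs →
  mapMaybe f (filter (T? ∘ p) xs) ≡ mapMaybe (λ x → gate (p x) (f x)) xs
mapMaybe-filter p f []       = refl
mapMaybe-filter p f (x ∷ xs) with p x
... | false = mapMaybe-filter p f xs
... | true  with f x
...   | just y  = cong (y ∷_) (mapMaybe-filter p f xs)
...   | nothing = mapMaybe-filter p f xs

∑-≟ : ∀ (i : Fin K) k → ∑ (allFin K) (λ j → ⟦ does (j ≟ᶠ i) ⟧ * k) ≡ k
∑-≟ {suc K} zero    k = trans (∑-allFin-suc {K} (λ j → ⟦ does (j ≟ᶠ zero) ⟧ * k))
  (trans (cong (k + 0 +_) (∑-zero (allFin K))) (trans (+-identityʳ _) (+-identityʳ k)))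
∑-≟ {suc K} (suc i) k = trans (∑-allFin-suc {K} (λ j → ⟦ does (j ≟ᶠ suc i) ⟧ * k)) (∑-≟ i k)

∑-without : ∀ (f : Fin K → ℕ) i →
  ∑ (allFin K) f ≤ ∑ (allFin K) (λ j → ⟦ not (does (j ≟ᶠ i)) ⟧ * f j) + f i
∑-without {K} f i = begin
  ∑ (allFin K) f
    ≤⟨ ∑-mono (allFin K) pointwise ⟩
  ∑ (allFin K) (λ j → ⟦ not (does (j ≟ᶠ i)) ⟧ * f j + ⟦ does (j ≟ᶠ i) ⟧ * f i)
    ≡⟨ ∑-+ (allFin K) _ _ ⟩
  ∑ (allFin K) (λ j → ⟦ not (does (j ≟ᶠ i)) ⟧ * f j) + ∑ (allFin K) (λ j → ⟦ does (j ≟ᶠ i) ⟧ * f i)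
    ≡⟨ cong (∑ (allFin K) (λ j → ⟦ not (does (j ≟ᶠ i)) ⟧ * f j) +_) (∑-≟ i (f i)) ⟩
  ∑ (allFin K) (λ j → ⟦ not (does (j ≟ᶠ i)) ⟧ * f j) + f i ∎
  where
  open ≤-Reasoning
  pointwise : ∀ j → f j ≤ ⟦ not (does (j ≟ᶠ i)) ⟧ * f j + ⟦ does (j ≟ᶠ i) ⟧ * f i
  pointwise j with j ≟ᶠ i
  ... | yes refl = m≤m+n (f j) 0
  ... | no _     = ≤-trans (m≤m+n (f j) 0) (m≤m+n _ 0)

⟦⟧≤1 : ∀ b → ⟦ b ⟧ ≤ 1
⟦⟧≤1 true  = ≤-refl
⟦⟧≤1 false = z≤n

-- Executions with an arbitrary hearing relation

module Simulation (A : Algorithm) where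
  open Algorithm A
  open Execution A

  listening : Device → Bool
  listening (acting _ (listen _) _) = true
  listening _                       = false

  transmitting : Device → Bool
  transmitting d = is-just (sent d)

  module _ {n : ℕ} where
    inbox : (Fin n → Fin n → Bool) → (Fin n → Device) → Fin n → List Message
    inbox h d v = mapMaybe (λ u → sent (d u)) (filter (λ u → T? (h v u)) (allFin n))

    -- An execution in which v hears only the vertices u with h v u.
    simulate : (Fin n → Fin n → Bool) → (Fin n → State) → (Fin n → List Bool) → ℕ → Fin n → Device
    simulate h σ τ zero    v = resume 0 (σ v) (τ v)
    simulate h σ τ (suc r) v = finishRound (feedback (inbox h (simulate h σ τ r) v)) (simulate h σ τ r v)

    inbox-cong : ∀ h h′ d d′ v v′ →
      (∀ u → gate (h v u) (sent (d u)) ≡ gate (h′ v′ u) (sent (d′ u))) → inbox h d v ≡ inbox h′ d′ v′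
    inbox-cong h h′ d d′ v v′ eq = begin
      inbox h d v
        ≡⟨ mapMaybe-filter (h v) (λ u → sent (d u)) (allFin n) ⟩
      mapMaybe (λ u → gate (h v u) (sent (d u))) (allFin n)
        ≡⟨ mapMaybe-cong eq (allFin n) ⟩
      mapMaybe (λ u → gate (h′ v′ u) (sent (d′ u))) (allFin n)
        ≡⟨ mapMaybe-filter (h′ v′) (λ u → sent (d′ u)) (allFin n) ⟨
      inbox h′ d′ v′ ∎
      where open ≡-Reasoning

    inbox-cong-≡ : ∀ h h′ d d′ v v′ → (∀ u → h v u ≡ h′ v′ u) → (∀ u → T (h v u) → d u ≡ d′ u) →
                   inbox h d v ≡ inbox h′ d′ v′
    inbox-cong-≡ h h′ d d′ v v′ h≡ d≡ = inbox-cong h h′ d d′ v v′ λ u →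
      trans (lemma (h v u) (d≡ u)) (cong (λ b → gate b (sent (d′ u))) (h≡ u))
      where
      lemma : ∀ b {e e′} → (T b → e ≡ e′) → gate b (sent e) ≡ gate b (sent e′)
      lemma true  eq = cong sent (eq tt)
      lemma false eq = refl

    length-inbox : ∀ h d v →
      length (inbox h d v) ≡ ∑ (allFin n) (λ u → ⟦ h v u ∧ transmitting (d u) ⟧)
    length-inbox h d v = length-mapMaybe-filter (λ u → T? (h v u)) (λ u → sent (d u)) (allFin n)

    module Alike (h h′ : Fin n → Fin n → Bool) (σ : Fin n → State) (τ τ′ : Fin n → List Bool) where
      -- These three data, together with the behaviour of the vertices heard, determine the run of a
      -- device.
      Alike : Fin n → Fin n → Set
      Alike w w′ = σ w ≡ σ w′ × τ w ≡ τ′ w′ × (∀ u → h w u ≡ h′ w′ u)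

      -- Only vertices that somebody hears have to match, so muted ones may differ arbitrarily. That
      -- `w` and `w′` may be different vertices is what allows an entry to be moved from one vertex
      -- of a pair to the other.
      simulate-alike : (∀ w u → T (h w u) → Alike u u) →
        ∀ r {w w′} → Alike w w′ → simulate h σ τ r w ≡ simulate h′ σ τ′ r w′
      simulate-alike hereditary zero    (σ≡ , τ≡ , h≡) = cong₂ (resume 0) σ≡ τ≡
      simulate-alike hereditary (suc r) {w} {w′} w~w′@(σ≡ , τ≡ , h≡) = cong₂ finishRound
        (cong feedback (inbox-cong-≡ h h′ _ _ w w′ h≡ (λ u hwu → simulate-alike hereditary r (hereditary w u hwu))))
        (simulate-alike hereditary r w~w′)

    finishRound-cong : ∀ {f f′ d d′} → d ≡ d′ → (T (listening d) → f ≡ f′) →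
                       finishRound f d ≡ finishRound f′ d′
    finishRound-cong {d = d@(acting _ (listen _) _)} refl eq = cong (λ f → finishRound f d) (eq tt)
    finishRound-cong {d = acting _ (transmit _ _) _} refl eq = refl
    finishRound-cong {d = acting _ (idle _) _}       refl eq = refl
    finishRound-cong {d = halted _ _}                refl eq = refl
    finishRound-cong {d = starved}                   refl eq = refl

  feedback-collision : ∀ ms → 2 ≤ length ms → feedback ms ≡ collision
  feedback-collision (_ ∷ [])    (s≤s ())
  feedback-collision (_ ∷ _ ∷ _) _ = refl

  resume-energy : ∀ e q cs → resume e q cs ≢ starved →
                  e + ⟦ listening (resume e q cs) ⟧ ≤ energy (resume e q cs)
  resume-energy e q cs alive with program q
  ... | act (listen _)     = ≤-refl
  ... | act (transmit _ _) = +-monoʳ-≤ e z≤n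
  ... | act (idle _)       = ≤-refl
  ... | halt _             = ≤-reflexive (+-identityʳ e)
  resume-energy e q []       alive | toss k = ⊥-elim (alive refl)
  resume-energy e q (b ∷ cs) alive | toss k = resume-energy e (k b) cs alive

  module _ {n} (h : Fin n → Fin n → Bool) (σ : Fin n → State) (τ : Fin n → List Bool) (v : Fin n) where
    private
      D : ℕ → Device
      D r = simulate h σ τ r v

    simulate-alive-pred : ∀ r → D (suc r) ≢ starved → D r ≢ starved
    simulate-alive-pred r alive eq = alive (cong (finishRound _) eq)

    -- The energy of a device already accounts for the current round.
    listens≤energy : ∀ r → D r ≢ starved → ∑ (downFrom (suc r)) (λ r → ⟦ listening (D r) ⟧) ≤ energy (D r)
    listens≤energy zero    alive = ≤-trans (≤-reflexive (+-identityʳ _)) (resume-energy 0 _ _ alive)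
    listens≤energy (suc r) alive = step (D r) alive (listens≤energy r (simulate-alive-pred r alive))
      where
      S = ∑ (downFrom (suc r)) (λ r → ⟦ listening (D r) ⟧)
      f = feedback (inbox h (simulate h σ τ r) v)
      step′ : ∀ e q cs → resume e q cs ≢ starved → S ≤ e →
              ⟦ listening (resume e q cs) ⟧ + S ≤ energy (resume e q cs)
      step′ e q cs alive′ S≤e = begin
        ⟦ listening (resume e q cs) ⟧ + S ≤⟨ +-monoʳ-≤ ⟦ listening (resume e q cs) ⟧ S≤e ⟩
        ⟦ listening (resume e q cs) ⟧ + e ≡⟨ +-comm _ e ⟩
        e + ⟦ listening (resume e q cs) ⟧ ≤⟨ resume-energy e q cs alive′ ⟩
        energy (resume e q cs)            ∎
        where open ≤-Reasoning
      step : ∀ d → finishRound f d ≢ starved → S ≤ energy d →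
             ⟦ listening (finishRound f d) ⟧ + S ≤ energy (finishRound f d)
      step (acting e (listen k) cs)     alive′ S≤ = step′ e (k f) cs alive′ S≤
      step (acting e (transmit _ q) cs) alive′ S≤ = step′ e q cs alive′ S≤
      step (acting e (idle q) cs)       alive′ S≤ = step′ e q cs alive′ S≤
      step (halted e o)                 alive′ S≤ = S≤
      step starved                      alive′ S≤ = ⊥-elim (alive′ refl)

  -- Muting a pair of vertices

  module Network {K m : ℕ} (σ : Fin (2 + K) → State)
                 (σ-uniform : ∀ i j → σ (suc (suc i)) ≡ σ (suc (suc j)))
                 (a b : Coins m) where

    -- The first bit of an entry says whether the vertex is adjacent to t, the
    -- others are its coins.
    Configuration : Set
    Configuration = Vec (Coins (suc m)) K

    types : Configuration → Vec Bool K
    types c = Vec.map Vec.head c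

    tapes : Configuration → Fin (2 + K) → List Bool
    tapes c 0F            = toList a
    tapes c 1F            = toList b
    tapes c (suc (suc i)) = toList (Vec.tail (lookup c i))

    hub : Fin 2 → Fin (2 + K)
    hub 0F = 0F
    hub 1F = 1F

    exec : Configuration → ℕ → Fin (2 + K) → Device
    exec c = simulate (link (types c)) σ (tapes c)

    link-hub-type : ∀ c c′ i j w → lookup c i ≡ lookup c′ j →
      link (types c) (hub w) (suc (suc i)) ≡ link (types c′) (hub w) (suc (suc j))
    link-hub-type c c′ i j 0F eq = refl
    link-hub-type c c′ i j 1F eq =
      trans (lookup-map i Vec.head c) (trans (cong Vec.head eq) (sym (lookup-map j Vec.head c′)))

    link-type : ∀ c c′ i j q → lookup c i ≡ lookup c′ j →
      link (types c) (suc (suc i)) q ≡ link (types c′) (suc (suc j)) q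
    link-type c c′ i j 0F            eq = refl
    link-type c c′ i j 1F            eq = link-hub-type c c′ i j 1F eq
    link-type c c′ i j (suc (suc _)) eq = refl

    sends : Configuration → ℕ → Fin 2 → Fin K → ℕ
    sends c r w i = ⟦ link (types c) (hub w) (suc (suc i)) ∧ transmitting (exec c r (suc (suc i))) ⟧

    sends≤1 : ∀ c r w i → sends c r w i ≤ 1
    sends≤1 c r w i = ⟦⟧≤1 (link (types c) (hub w) (suc (suc i)) ∧ transmitting (exec c r (suc (suc i))))

    module Pair (u v : Fin K) where

      other : Fin K → Bool
      other i = not (does (i ≟ᶠ u)) ∧ not (does (i ≟ᶠ v))

      audible : Fin (2 + K) → Bool
      audible 0F            = true
      audible 1F            = true
      audible (suc (suc i)) = other i

      -- Only the second argument, the sender, is tested: the pair still hears the hubs and goes on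
      -- acting, without being heard. What it would have sent can thus be inspected.
      muted : Configuration → Fin (2 + K) → Fin (2 + K) → Bool
      muted c w q = link (types c) w q ∧ audible q

      exec′ : Configuration → ℕ → Fin (2 + K) → Device
      exec′ c = simulate (muted c) σ (tapes c)

      _≈_ : Configuration → Configuration → Set
      c ≈ c′ = ∀ i → T (other i) → lookup c i ≡ lookup c′ i

      module _ {c c′} (c≈c′ : c ≈ c′) where
        open Alike (muted c) (muted c′) σ (tapes c) (tapes c′)

        muted-hub : ∀ w q → muted c (hub w) q ≡ muted c′ (hub w) q
        muted-hub 0F 0F            = refl
        muted-hub 0F 1F            = refl
        muted-hub 0F (suc (suc i)) = refl
        muted-hub 1F 0F            = refl
        muted-hub 1F 1F            = refl
        muted-hub 1F (suc (suc i)) with other i in eq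
        ... | true  = cong (_∧ true) (link-hub-type c c′ i i 1F (c≈c′ i (subst T (sym eq) tt)))
        ... | false = trans (∧-zeroʳ _) (sym (∧-zeroʳ _))

        alike-hub : ∀ w → Alike (hub w) (hub w)
        alike-hub 0F = refl , refl , muted-hub 0F
        alike-hub 1F = refl , refl , muted-hub 1F

        alike-entry : ∀ {i j} → lookup c i ≡ lookup c′ j → Alike (suc (suc i)) (suc (suc j))
        alike-entry {i} {j} eq = σ-uniform i j , cong (toList ∘ Vec.tail) eq ,
          λ q → cong (_∧ audible q) (link-type c c′ i j q eq)

        T-∧ʳ : ∀ {x y} → T (x ∧ y) → T y
        T-∧ʳ {true} p = p

        hereditary : ∀ w q → T (muted c w q) → Alike q q
        hereditary w 0F            _ = alike-hub 0F
        hereditary w 1F            _ = alike-hub 1F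
        hereditary w (suc (suc i)) p = alike-entry (c≈c′ i (T-∧ʳ {link (types c) w (suc (suc i))} p))

        exec′-hub : ∀ r w → exec′ c r (hub w) ≡ exec′ c′ r (hub w)
        exec′-hub r w = simulate-alike hereditary r (alike-hub w)

        -- Ordinary vertices start alike and hear only hubs, and the hubs of the muted run do not
        -- depend on the pair. So the behaviour of a vertex is a function of its own entry once the
        -- entries outside the pair are fixed, and the same function for every position.
        exec′-entry : ∀ r {i j} → lookup c i ≡ lookup c′ j →
                      exec′ c r (suc (suc i)) ≡ exec′ c′ r (suc (suc j))
        exec′-entry r eq = simulate-alike hereditary r (alike-entry eq)

        inbox′-hub : ∀ r w → inbox (muted c) (exec′ c r) (hub w) ≡ inbox (muted c′) (exec′ c′ r) (hub w)
        inbox′-hub r w = inbox-cong-≡ (muted c) (muted c′) _ _ (hub w) (hub w) (muted-hub w)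
          (λ q p → simulate-alike hereditary r (hereditary (hub w) q p))

      -- In round r of the muted execution, what i sends would not change what
      -- the hubs hear.
      Harmless : Configuration → Fin K → ℕ → Set
      Harmless c i r = ∀ w → T (listening (exec′ c r (hub w))) →
        T (link (types c) (hub w) (suc (suc i)) ∧ transmitting (exec′ c r (suc (suc i)))) →
        2 ≤ length (inbox (muted c) (exec′ c r) (hub w))

      harmless? : ∀ c i r → Dec (Harmless c i r)
      harmless? c i r = allFin? λ w → T? _ →-dec T? _ →-dec 2 ≤? _

      Quiet : Configuration → ℕ → Fin K → Set
      Quiet c R i = ∀ {r} → r < R → Harmless c i r

      quiet? : ∀ c R i → Dec (Quiet c R i)
      quiet? c R i = allUpTo? (harmless? c i) R

      -- Quietness is judged in the muted run, hence it is a property of an entry relative to the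
      -- rest, and neither of its position nor of the other entry of the pair. This gives `u` and
      -- `v` one common quiet set and makes their quiet data a product.
      quiet-resp : ∀ {c c′ R i j} → c ≈ c′ → lookup c i ≡ lookup c′ j → Quiet c R i → Quiet c′ R j
      quiet-resp {c} {c′} {R} {i} {j} c≈c′ eq quiet {r} r<R w listens transmits = subst (2 ≤_)
        (cong length (inbox′-hub c≈c′ r w))
        (quiet r<R w
          (subst T (cong listening (sym (exec′-hub c≈c′ r w))) listens)
          (subst T (sym (cong₂ _∧_ (link-hub-type c c′ i j w eq)
                                   (cong transmitting (exec′-entry c≈c′ r eq)))) transmits))

      quiet?-resp : ∀ {c c′ i j} R → c ≈ c′ → lookup c i ≡ lookup c′ j →
                    does (quiet? c R i) ≡ does (quiet? c′ R j)
      quiet?-resp {c} {c′} {i} {j} R c≈c′ eq = does-⇔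
        (mk⇔ (quiet-resp c≈c′ eq) (quiet-resp (λ k o → sym (c≈c′ k o)) (sym eq)))
        (quiet? c R i) (quiet? c′ R j)

      muted≤full : ∀ c d w → length (inbox (muted c) d w) ≤ length (inbox (link (types c)) d w)
      muted≤full c d w = begin
        length (inbox (muted c) d w)
          ≡⟨ length-inbox (muted c) d w ⟩
        ∑ (allFin (2 + K)) (λ q → ⟦ muted c w q ∧ transmitting (d q) ⟧)
          ≤⟨ ∑-mono (allFin (2 + K)) (λ q → lemma (link (types c) w q) (audible q) _) ⟩
        ∑ (allFin (2 + K)) (λ q → ⟦ link (types c) w q ∧ transmitting (d q) ⟧)
          ≡⟨ length-inbox (link (types c)) d w ⟨
        length (inbox (link (types c)) d w) ∎
        where
        open ≤-Reasoning
        lemma : ∀ x y z → ⟦ (x ∧ y) ∧ z ⟧ ≤ ⟦ x ∧ z ⟧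
        lemma true  true  z = ≤-refl
        lemma true  false z = z≤n
        lemma false y     z = z≤n

      module _ (c : Configuration) where
        private
          -- If a listening hub has two audible senders, it hears a collision with or without the
          -- pair. Otherwise harmlessness forces the pair to be silent towards it, and the two
          -- inboxes coincide. Every other vertex hears only hubs, which are never muted.
          feedback-agrees : ∀ r → (∀ q → exec c r q ≡ exec′ c r q) →
            Harmless c u r → Harmless c v r → ∀ w → T (listening (exec′ c r w)) →
            feedback (inbox (link (types c)) (exec c r) w) ≡ feedback (inbox (muted c) (exec′ c r) w)
          feedback-agrees r agree hu hv w listens =
            trans (cong feedback (inbox-cong-≡ (link (types c)) (link (types c)) (exec c r) (exec′ c r) w w
                                               (λ _ → refl) (λ q _ → agree q)))
                  (at w listens)
            where
            d = exec′ c r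
            at-hub : ∀ w → T (listening (d (hub w))) →
              feedback (inbox (link (types c)) d (hub w)) ≡ feedback (inbox (muted c) d (hub w))
            at-hub w listens with 2 ≤? length (inbox (muted c) d (hub w))
            ... | yes 2≤ = trans (feedback-collision _ (≤-trans 2≤ (muted≤full c d (hub w))))
                                 (sym (feedback-collision _ 2≤))
            ... | no 2≰ = cong feedback (inbox-cong (link (types c)) (muted c) d d (hub w) (hub w) same)
              where
              silent : ∀ i → Harmless c i r →
                gate (link (types c) (hub w) (suc (suc i))) (sent (d (suc (suc i)))) ≡ nothing
              silent i hi with link (types c) (hub w) (suc (suc i)) | sent (d (suc (suc i))) | hi w listens
              ... | false | _       | _     = refl
              ... | true  | nothing | _     = refl
              ... | true  | just _  | noisy = ⊥-elim (2≰ (noisy tt))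
              gate-∧false : ∀ x (y : Maybe Message) → gate x y ≡ nothing → gate x y ≡ gate (x ∧ false) y
              gate-∧false x y eq rewrite ∧-zeroʳ x = eq
              same : ∀ q → gate (link (types c) (hub w) q) (sent (d q)) ≡ gate (muted c (hub w) q) (sent (d q))
              same 0F = cong (λ x → gate x (sent (d 0F))) (sym (∧-identityʳ _))
              same 1F = cong (λ x → gate x (sent (d 1F))) (sym (∧-identityʳ _))
              same (suc (suc i)) with i ≟ᶠ u | i ≟ᶠ v
              ... | yes refl | _        = gate-∧false (link (types c) (hub w) (suc (suc i))) (sent (d (suc (suc i)))) (silent i hu)
              ... | no _     | yes refl = gate-∧false (link (types c) (hub w) (suc (suc i))) (sent (d (suc (suc i)))) (silent i hv)
              ... | no _     | no _     = cong (λ x → gate x (sent (d (suc (suc i))))) (sym (∧-identityʳ _))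
            at : ∀ w → T (listening (d w)) →
              feedback (inbox (link (types c)) d w) ≡ feedback (inbox (muted c) d w)
            at 0F listens = at-hub 0F listens
            at 1F listens = at-hub 1F listens
            at (suc (suc i)) _ = cong feedback
              (inbox-cong-≡ (link (types c)) (muted c) d d (suc (suc i)) (suc (suc i))
                same (λ _ _ → refl))
              where
              same : ∀ q → link (types c) (suc (suc i)) q ≡ muted c (suc (suc i)) q
              same 0F            = refl
              same 1F            = sym (∧-identityʳ _)
              same (suc (suc _)) = refl

        -- The state in round `R` is shaped by feedback from strictly earlier rounds only, which is
        -- why `Quiet` ranges over `r < R`.
        exec≡exec′ : ∀ R → Quiet c R u → Quiet c R v → ∀ q → exec c R q ≡ exec′ c R q
        exec≡exec′ zero    _  _  q = refl
        exec≡exec′ (suc R) qu qv q = finishRound-cong {n = 2 + K} (agree q)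
          (λ listens → feedback-agrees R agree (qu ≤-refl) (qv ≤-refl) q
                         (subst (T ∘ listening) (agree q) listens))
          where
          agree : ∀ q → exec c R q ≡ exec′ c R q
          agree = exec≡exec′ R (λ r<R → qu (m<n⇒m<1+n r<R)) (λ r<R → qv (m<n⇒m<1+n r<R))

        -- A listening round of a hub in which one of u and v is needed to tell the
        -- feedback.
        Charged : ℕ → Fin 2 → Set
        Charged r w = T (listening (exec c r (hub w)))
                    × 1 ≤ sends c r w u + sends c r w v
                    × ∑ (allFin K) (sends c r w) ≤ 1 + (sends c r w u + sends c r w v)

        charged? : ∀ r w → Dec (Charged r w)
        charged? r w = T? _ ×-dec (1 ≤? _) ×-dec (_ ≤? _)

        private
          count-audible : ∀ r w →
            ∑ (allFin K) (sends c r w) ≤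
            length (inbox (muted c) (exec c r) (hub w)) + (sends c r w u + sends c r w v)
          count-audible r w = begin
            ∑ (allFin K) f
              ≤⟨ ∑-without f u ⟩
            ∑ (allFin K) g + f u
              ≤⟨ +-monoˡ-≤ (f u) (∑-without g v) ⟩
            ∑ (allFin K) (λ j → ⟦ not (does (j ≟ᶠ v)) ⟧ * g j) + g v + f u
              ≤⟨ +-monoˡ-≤ (f u) (+-mono-≤ (∑-mono (allFin K) pointwise) (g≤f v)) ⟩
            ∑ (allFin K) (λ j → F (suc (suc j))) + f v + f u
              ≡⟨ trans (+-assoc _ (f v) (f u)) (cong (∑ (allFin K) (λ j → F (suc (suc j))) +_) (+-comm (f v) (f u))) ⟩
            ∑ (allFin K) (λ j → F (suc (suc j))) + (f u + f v)
              ≤⟨ +-monoˡ-≤ (f u + f v) (≤-trans (m≤n+m _ (F 1F)) (m≤n+m _ (F 0F))) ⟩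
            F 0F + (F 1F + ∑ (allFin K) (λ j → F (suc (suc j)))) + (f u + f v)
              ≡⟨ cong (_+ (f u + f v)) (trans (length-inbox (muted c) (exec c r) (hub w)) (∑-allFin-2+ F)) ⟨
            length (inbox (muted c) (exec c r) (hub w)) + (f u + f v) ∎
            where
            open ≤-Reasoning
            f g : Fin K → ℕ
            f = sends c r w
            g j = ⟦ not (does (j ≟ᶠ u)) ⟧ * f j
            F : Fin (2 + K) → ℕ
            F q = ⟦ muted c (hub w) q ∧ transmitting (exec c r q) ⟧
            g≤f : ∀ j → g j ≤ f j
            g≤f j with not (does (j ≟ᶠ u))
            ... | true  = ≤-reflexive (+-identityʳ _)
            ... | false = z≤n
            lemma : ∀ x p q z → ⟦ q ⟧ * (⟦ p ⟧ * ⟦ x ∧ z ⟧) ≤ ⟦ (x ∧ (p ∧ q)) ∧ z ⟧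
            lemma true  true  true  true  = ≤-refl
            lemma true  true  true  false = z≤n
            lemma false p     q     z     = ≤-reflexive (trans (cong (⟦ q ⟧ *_) (*-zeroʳ ⟦ p ⟧)) (*-zeroʳ ⟦ q ⟧))
            lemma true  false q     z     = ≤-trans (≤-reflexive (*-zeroʳ ⟦ q ⟧)) z≤n
            lemma true  true  false z     = z≤n
            pointwise : ∀ j → ⟦ not (does (j ≟ᶠ v)) ⟧ * g j ≤ F (suc (suc j))
            pointwise j = lemma (link (types c) (hub w) (suc (suc j))) (not (does (j ≟ᶠ u)))
                                (not (does (j ≟ᶠ v))) (transmitting (exec c r (suc (suc j))))

          1≤⟦⟧ : ∀ {b} → T b → 1 ≤ ⟦ b ⟧
          1≤⟦⟧ {true} _ = ≤-refl

          -- A harmful transmission reaches a listening hub that has at most one audible sender, so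
          -- all further senders belong to the pair. The hypothesis on `sends` stands for `i` being
          -- `u` or `v`.
          harmful⇒charged : ∀ r → (∀ q → exec c r q ≡ exec′ c r q) → ∀ i →
            (∀ w → sends c r w i ≤ sends c r w u + sends c r w v) →
            ¬ Harmless c i r → ∃[ w ] Charged r w
          harmful⇒charged r agree i i≤ harmful
            with w , harmful-w ← ¬∀⟶∃¬ 2 _ (λ w → T? _ →-dec T? _ →-dec 2 ≤? _) harmful
            with listens , ¬rest ← ¬→⇒ (T? _) harmful-w
            with transmits , 2≰ ← ¬→⇒ (T? _) ¬rest =
            w , subst (T ∘ listening) (sym (agree (hub w))) listens
              , ≤-trans (1≤⟦⟧ (subst (λ e → T (link (types c) (hub w) (suc (suc i)) ∧ transmitting e))
                                     (sym (agree (suc (suc i)))) transmits)) (i≤ w)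
              , ≤-trans (count-audible r w) (+-monoˡ-≤ _ (s≤s⁻¹ (≰⇒> (subst (λ l → ¬ 2 ≤ l)
                  (cong length (inbox-cong-≡ (muted c) (muted c) (exec′ c r) (exec c r) (hub w) (hub w)
                    (λ _ → refl) (λ q _ → sym (agree q)))) 2≰))))

          -- `Harmless` speaks of the muted run and `Charged` of the real one. At the first harmful
          -- round the two runs still agree, so the disturbance is visible in the real run, which
          -- all pairs share.
          first-charge : ∀ R → (Quiet c R u × Quiet c R v) ⊎ (∃[ r ] (r < R × ∃[ w ] Charged r w))
          first-charge zero = inj₁ ((λ ()) , (λ ()))
          first-charge (suc R) with first-charge R
          ... | inj₂ (r , r<R , charged) = inj₂ (r , m<n⇒m<1+n r<R , charged)
          ... | inj₁ (qu , qv) with harmless? c u R | harmless? c v R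
          ...   | no ¬hu | _      = inj₂ (R , ≤-refl ,
                  harmful⇒charged R (exec≡exec′ R qu qv) u (λ w → m≤m+n _ _) ¬hu)
          ...   | yes _  | no ¬hv = inj₂ (R , ≤-refl ,
                  harmful⇒charged R (exec≡exec′ R qu qv) v (λ w → m≤n+m _ _) ¬hv)
          ...   | yes hu | yes hv = inj₁ (extend qu hu , extend qv hv)
            where
            extend : ∀ {i} → Quiet c R i → Harmless c i R → Quiet c (suc R) i
            extend {i} q h {r} r<1+R with m≤n⇒m<n∨m≡n (s≤s⁻¹ r<1+R)
            ... | inj₁ r<R  = q r<R
            ... | inj₂ refl = h

        term≤∑downFrom : ∀ (f : ℕ → ℕ) {r R} → r < R → f r ≤ ∑ (downFrom R) f
        term≤∑downFrom f {r} {suc R} r<1+R with m≤n⇒m<n∨m≡n (s≤s⁻¹ r<1+R)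
        ... | inj₁ r<R  = ≤-trans (term≤∑downFrom f r<R) (m≤n+m _ (f R))
        ... | inj₂ refl = m≤m+n _ _

        free : ℕ → Bool
        free R = does (quiet? c R u) ∧ does (quiet? c R v)

        free⇒quiet : ∀ R → free R ≡ true → Quiet c R u × Quiet c R v
        free⇒quiet R eq with yes qu ← quiet? c R u | yes qv ← quiet? c R v = qu , qv

        unfree≤charges : ∀ R →
          ⟦ not (free R) ⟧ ≤ ∑ (downFrom R) (λ r → ∑ (allFin 2) (λ w → ⟦ does (charged? r w) ⟧))
        unfree≤charges R with first-charge R
        ... | inj₁ (qu , qv) = ≤-trans (≤-reflexive (cong (⟦_⟧ ∘ not)
          (cong₂ _∧_ (dec-true (quiet? c R u) qu) (dec-true (quiet? c R v) qv)))) z≤n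
        ... | inj₂ (r , r<R , w , charged) = begin
          ⟦ not (free R) ⟧                                ≤⟨ ⟦⟧≤1 (not (free R)) ⟩
          1                                               ≡⟨ cong ⟦_⟧ (dec-true (charged? r w) charged) ⟨
          ⟦ does (charged? r w) ⟧                         ≤⟨ term≤∑ (λ w → ⟦ does (charged? r w) ⟧) w ⟩
          ∑ (allFin 2) (λ w → ⟦ does (charged? r w) ⟧)    ≤⟨ term≤∑downFrom _ r<R ⟩
          ∑ (downFrom R) (λ r → ∑ (allFin 2) (λ w → ⟦ does (charged? r w) ⟧)) ∎
          where open ≤-Reasoning

-- Counting configurations

bitSum-update : ∀ {K m} (c : Vec (Coins (suc m)) K) i →
  ∃[ k ] (∀ y → bitSum (Vec.map Vec.head (c [ i ]≔ y)) ≡ k + ⟦ Vec.head y ⟧)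
bitSum-update (_ ∷ᵛ c) zero    = _ , λ y → +-comm ⟦ Vec.head y ⟧ _
bitSum-update (x ∷ᵛ c) (suc i) with bitSum-update c i
... | k , eq = ⟦ Vec.head x ⟧ + k , λ y → trans (cong (⟦ Vec.head x ⟧ +_) (eq y)) (sym (+-assoc ⟦ Vec.head x ⟧ k _))

-- The witness is the contribution of the remaining entries; what matters is that it is chosen
-- before `y` and `z`.
bitSum-update₂ : ∀ {K m} (c : Vec (Coins (suc m)) K) {i j} → i ≢ j →
  ∃[ k ] (∀ y z → bitSum (Vec.map Vec.head (c [ i ]≔ y [ j ]≔ z)) ≡ k + ⟦ Vec.head y ⟧ + ⟦ Vec.head z ⟧)
bitSum-update₂ (_ ∷ᵛ c) {zero}  {zero}  i≢j = ⊥-elim (i≢j refl)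
bitSum-update₂ (_ ∷ᵛ c) {zero}  {suc j} i≢j with bitSum-update c j
... | k , eq = k , λ y z → trans (cong (⟦ Vec.head y ⟧ +_) (eq z)) (lemma ⟦ Vec.head y ⟧ k ⟦ Vec.head z ⟧)
  where
  lemma : ∀ a b c → a + (b + c) ≡ b + a + c
  lemma = solve-∀
bitSum-update₂ (_ ∷ᵛ c) {suc i} {zero}  i≢j with bitSum-update c i
... | k , eq = k , λ y z → trans (cong (⟦ Vec.head z ⟧ +_) (eq y)) (+-comm ⟦ Vec.head z ⟧ _)
bitSum-update₂ (x ∷ᵛ c) {suc i} {suc j} i≢j with bitSum-update₂ c (λ eq → i≢j (cong suc eq))
... | k , eq = ⟦ Vec.head x ⟧ + k , λ y z →
  trans (cong (⟦ Vec.head x ⟧ +_) (eq y z)) (lemma ⟦ Vec.head x ⟧ k ⟦ Vec.head y ⟧ ⟦ Vec.head z ⟧)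
  where
  lemma : ∀ a b c d → a + (b + c + d) ≡ a + b + c + d
  lemma = solve-∀

-- A fixed output o is wrong for mixed types, or else for both kinds of equal
-- types, which are at least as frequent.
mixed≤wrong : ∀ m (N : Coins (suc m) → ℕ) (o : Maybe ℕ) k →
  ∑ (coins (suc m)) (λ y → ∑ (coins (suc m)) (λ z → N y * (N z * ⟦ Vec.head y xor Vec.head z ⟧))) ≤
  ∑ (coins (suc m)) (λ y → ∑ (coins (suc m)) (λ z → N y * (N z *
    ⟦ not (does (Maybe.≡-dec _≟_ o (just (k + ⟦ Vec.head y ⟧ + ⟦ Vec.head z ⟧)))) ⟧)))
mixed≤wrong m N o k = begin
  ∑ (coins (suc m)) (λ y → ∑ (coins (suc m)) (λ z → N y * (N z * ⟦ Vec.head y xor Vec.head z ⟧)))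
    ≡⟨ ∑∑-by-heads m N (λ b c → ⟦ b xor c ⟧) ⟩
  a * (a * 0 + b * 1) + b * (a * 1 + b * 0)
    ≡⟨ lhs a b ⟩
  a * b + b * a
    ≤⟨ main ⟩
  a * (a * wrong true true + b * wrong true false) + b * (a * wrong false true + b * wrong false false)
    ≡⟨ ∑∑-by-heads m N wrong ⟨
  ∑ (coins (suc m)) (λ y → ∑ (coins (suc m)) (λ z → N y * (N z * wrong (Vec.head y) (Vec.head z)))) ∎
  where
  open ≤-Reasoning
  a b : ℕ
  a = ∑ (coins m) (λ w → N (true ∷ᵛ w))
  b = ∑ (coins m) (λ w → N (false ∷ᵛ w))
  wrong : Bool → Bool → ℕ
  wrong x y = ⟦ not (does (Maybe.≡-dec _≟_ o (just (k + ⟦ x ⟧ + ⟦ y ⟧)))) ⟧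
  lhs : ∀ a b → a * (a * 0 + b * 1) + b * (a * 1 + b * 0) ≡ a * b + b * a
  lhs = solve-∀
  rearrange : ∀ a b p q r s → a * (a * p + b * q) + b * (a * r + b * s) ≡
                              (a * a) * p + (b * b) * s + ((a * b) * q + (b * a) * r)
  rearrange = solve-∀
  wrong≡1 : ∀ {x y} → o ≢ just (k + ⟦ x ⟧ + ⟦ y ⟧) → wrong x y ≡ 1
  wrong≡1 {x} {y} ne = cong (⟦_⟧ ∘ not) (dec-false (Maybe.≡-dec _≟_ o (just (k + ⟦ x ⟧ + ⟦ y ⟧))) ne)
  just-injective : ∀ {x y : ℕ} → just x ≡ just y → x ≡ y
  just-injective refl = refl
  main : a * b + b * a ≤
         a * (a * wrong true true + b * wrong true false) + b * (a * wrong false true + b * wrong false false)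
  main with Maybe.≡-dec _≟_ o (just (k + 1))
  ... | yes o≡ = begin
    a * b + b * a
      ≤⟨ 2mn≤m²+n² a b ⟩
    a * a + b * b
      ≡⟨ cong₂ _+_ (*-identityʳ (a * a)) (*-identityʳ (b * b)) ⟨
    a * a * 1 + b * b * 1
      ≡⟨ cong₂ (λ p q → a * a * p + b * b * q)
           (wrong≡1 {true} {true} (λ eq → m≢1+m+n (k + 1) (trans (just-injective (trans (sym o≡) eq)) (tt₁ k))))
           (wrong≡1 {false} {false} (λ eq → m≢1+m+n k (trans (ff₀ k) (trans (just-injective (trans (sym eq) o≡)) (ff₁ k))))) ⟨
    a * a * wrong true true + b * b * wrong false false
      ≤⟨ m≤m+n (a * a * wrong true true + b * b * wrong false false) (a * b * wrong true false + b * a * wrong false true) ⟩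
    a * a * wrong true true + b * b * wrong false false + (a * b * wrong true false + b * a * wrong false true)
      ≡⟨ rearrange a b (wrong true true) (wrong true false) (wrong false true) (wrong false false) ⟨
    a * (a * wrong true true + b * wrong true false) + b * (a * wrong false true + b * wrong false false) ∎
    where
    tt₁ : ∀ k → k + 1 + 1 ≡ suc (k + 1 + 0)
    tt₁ = solve-∀
    ff₀ : ∀ k → k ≡ k + 0 + 0
    ff₀ = solve-∀
    ff₁ : ∀ k → k + 1 ≡ suc (k + 0)
    ff₁ = solve-∀
  ... | no o≢ = begin
    a * b + b * a
      ≡⟨ cong₂ _+_ (*-identityʳ (a * b)) (*-identityʳ (b * a)) ⟨
    a * b * 1 + b * a * 1
      ≡⟨ cong₂ (λ p q → a * b * p + b * a * q)
           (wrong≡1 {true} {false} (λ eq → o≢ (trans eq (cong just (+-identityʳ (k + 1))))))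
           (wrong≡1 {false} {true} (λ eq → o≢ (trans eq (cong (λ x → just (x + 1)) (+-identityʳ k))))) ⟨
    a * b * wrong true false + b * a * wrong false true
      ≤⟨ m≤n+m (a * b * wrong true false + b * a * wrong false true) (a * a * wrong true true + b * b * wrong false false) ⟩
    a * a * wrong true true + b * b * wrong false false + (a * b * wrong true false + b * a * wrong false true)
      ≡⟨ rearrange a b (wrong true true) (wrong true false) (wrong false true) (wrong false false) ⟨
    a * (a * wrong true true + b * wrong true false) + b * (a * wrong false true + b * wrong false false) ∎

⟦⟧≡1 : ∀ {b} → T b → ⟦ b ⟧ ≡ 1
⟦⟧≡1 {true} _ = refl

absent-or : ∀ {P : Set} (p? : Dec P) → ⟦ does p? ⟧ ≡ 0 ⊎ P
absent-or (yes p) = inj₂ p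
absent-or (no _)  = inj₁ refl

refuted-or : ∀ {P : Set} (p? : Dec P) → ⟦ not (does p?) ⟧ ≡ 1 ⊎ P
refuted-or (yes p) = inj₂ p
refuted-or (no _)  = inj₁ refl

module Counting (A : Algorithm) {K m : ℕ} (σ : Fin (2 + K) → Algorithm.State A)
                (σ-uniform : ∀ i j → σ (suc (suc i)) ≡ σ (suc (suc j)))
                (a b : Coins m) where
  open Algorithm A
  open Execution A
  open Simulation A
  open Network σ σ-uniform a b

  Correct : Configuration → ℕ → Set
  Correct c R = ∀ q → output (exec c R q) ≡ just (bitSum (types c))

  correct? : ∀ c R → Dec (Correct c R)
  correct? c R = allFin? λ q → Maybe.≡-dec _≟_ (output (exec c R q)) (just (bitSum (types c)))

  wrong : ℕ → Configuration → ℕ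
  wrong R c = ⟦ not (does (correct? c R)) ⟧

  mixed : Fin K → Fin K → Configuration → ℕ
  mixed u v c = ⟦ Vec.head (lookup c u) xor Vec.head (lookup c v) ⟧

  module _ (R : ℕ) {u v : Fin K} (u≢v : u ≢ v) where
    open Pair u v

    module _ (c : Configuration) where
      private
        _,,_ : Coins (suc m) → Coins (suc m) → Configuration
        y ,, z = c [ u ]≔ y [ v ]≔ z

        lookup-u : ∀ y z → lookup (y ,, z) u ≡ y
        lookup-u y z = trans (lookup∘update′ u≢v (c [ u ]≔ y) z) (lookup∘update u c y)

        lookup-v : ∀ y z → lookup (y ,, z) v ≡ z
        lookup-v y z = lookup∘update v (c [ u ]≔ y) z

        lookup-other : ∀ y z i → T (other i) → lookup (y ,, z) i ≡ lookup c i
        lookup-other y z i o with i ≟ᶠ u | i ≟ᶠ v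
        ... | no i≢u | no i≢v = trans (lookup∘update′ i≢v (c [ u ]≔ y) z) (lookup∘update′ i≢u c y)

        ≈-update : ∀ y z y′ z′ → (y ,, z) ≈ (y′ ,, z′)
        ≈-update y z y′ z′ i o = trans (lookup-other y z i o) (sym (lookup-other y′ z′ i o))

        -- The second `y` is a filler: the entry at `v` does not affect whether the entry at `u` is
        -- quiet. By the same token `N` also decides the quietness of an entry at `v`.
        N : Coins (suc m) → Bool
        N y = does (quiet? (y ,, y) R u)

        free≡N∧N : ∀ y z → free (y ,, z) R ≡ N y ∧ N z
        free≡N∧N y z = cong₂ _∧_
          (quiet?-resp R (≈-update y z y y) (trans (lookup-u y z) (sym (lookup-u y y))))
          (quiet?-resp R (≈-update y z z z) (trans (lookup-v y z) (sym (lookup-u z z))))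

        -- The muted run of `c` itself serves as reference, since its hubs behave as in the muted
        -- run of every update of `c` at the pair.
        o : Maybe ℕ
        o = output (exec′ c R 0F)

        output-free : ∀ y z → free (y ,, z) R ≡ true → output (exec (y ,, z) R 0F) ≡ o
        output-free y z isFree with qu , qv ← free⇒quiet (y ,, z) R isFree = cong output
          (trans (exec≡exec′ (y ,, z) R qu qv 0F) (exec′-hub (lookup-other y z) R 0F))

        k : ℕ
        k = proj₁ (bitSum-update₂ c u≢v)

        bitSum-types : ∀ y z → bitSum (types (y ,, z)) ≡ k + ⟦ Vec.head y ⟧ + ⟦ Vec.head z ⟧
        bitSum-types = proj₂ (bitSum-update₂ c u≢v)

        wrong-free : ∀ y z →
          ⟦ N y ⟧ * (⟦ N z ⟧ * ⟦ not (does (Maybe.≡-dec _≟_ o (just (k + ⟦ Vec.head y ⟧ + ⟦ Vec.head z ⟧)))) ⟧) ≤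
          wrong R (y ,, z)
        wrong-free y z = if-both (N y) (N z) λ both → wrong-if-free (trans (free≡N∧N y z) both)
          where
          o? : Dec (o ≡ just (k + ⟦ Vec.head y ⟧ + ⟦ Vec.head z ⟧))
          o? = Maybe.≡-dec _≟_ o (just (k + ⟦ Vec.head y ⟧ + ⟦ Vec.head z ⟧))
          if-both : ∀ a b {x w} → (a ∧ b ≡ true → x ≤ w) → ⟦ a ⟧ * (⟦ b ⟧ * x) ≤ w
          if-both false b     x≤w = z≤n
          if-both true  false x≤w = z≤n
          if-both true  true  x≤w = ≤-trans (≤-reflexive (trans (+-identityʳ _) (+-identityʳ _))) (x≤w refl)
          wrong-if-free : free (y ,, z) R ≡ true → ⟦ not (does o?) ⟧ ≤ wrong R (y ,, z)
          wrong-if-free isFree with refuted-or (correct? (y ,, z) R)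
          ... | inj₁ refuted = ≤-trans (⟦⟧≤1 (not (does o?))) (≤-reflexive (sym refuted))
          ... | inj₂ correct = ≤-trans (≤-reflexive (cong (⟦_⟧ ∘ not) (dec-true o?
            (trans (sym (output-free y z isFree)) (trans (correct 0F) (cong just (bitSum-types y z))))))) z≤n

        mixed-free : ∀ y z → mixed u v (y ,, z) * ⟦ free (y ,, z) R ⟧ ≡
                     ⟦ N y ⟧ * (⟦ N z ⟧ * ⟦ Vec.head y xor Vec.head z ⟧)
        mixed-free y z = trans
          (cong₂ (λ x f → x * ⟦ f ⟧)
            (cong₂ (λ p q → ⟦ Vec.head p xor Vec.head q ⟧) (lookup-u y z) (lookup-v y z)) (free≡N∧N y z))
          (*-⟦∧⟧ (N y) (N z) ⟦ Vec.head y xor Vec.head z ⟧)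
          where
          *-⟦∧⟧ : ∀ a b x → x * ⟦ a ∧ b ⟧ ≡ ⟦ a ⟧ * (⟦ b ⟧ * x)
          *-⟦∧⟧ true  true  x = trans (*-identityʳ x) (sym (trans (+-identityʳ _) (+-identityʳ x)))
          *-⟦∧⟧ true  false x = *-zeroʳ x
          *-⟦∧⟧ false b     x = *-zeroʳ x

      -- Freeness of the updated pair factors into `N y` and `N z` with the same `N`, and on free
      -- updates s outputs the fixed `o`. This is the situation of `mixed≤wrong`; a wrong output of
      -- s alone already makes the run wrong.
      mixed-free≤wrong :
        ∑ (coins (suc m)) (λ y → ∑ (coins (suc m)) (λ z →
          mixed u v (c [ u ]≔ y [ v ]≔ z) * ⟦ free (c [ u ]≔ y [ v ]≔ z) R ⟧)) ≤
        ∑ (coins (suc m)) (λ y → ∑ (coins (suc m)) (λ z → wrong R (c [ u ]≔ y [ v ]≔ z)))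
      mixed-free≤wrong = begin
        _ ≡⟨ ∑-cong (coins (suc m)) (λ y → ∑-cong (coins (suc m)) (mixed-free y)) ⟩
        _ ≤⟨ mixed≤wrong m (⟦_⟧ ∘ N) o k ⟩
        _ ≤⟨ ∑-mono (coins (suc m)) (λ y → ∑-mono (coins (suc m)) (wrong-free y)) ⟩
        _ ∎
        where open ≤-Reasoning

      2*mixed : 2 * ∑ (coins (suc m)) (λ y → ∑ (coins (suc m)) (λ z → mixed u v (c [ u ]≔ y [ v ]≔ z))) ≡
                length (coins (suc m)) * length (coins (suc m))
      2*mixed = trans (cong (2 *_) (∑-cong (coins (suc m)) λ y → ∑-cong (coins (suc m)) λ z →
          cong₂ (λ p q → ⟦ Vec.head p xor Vec.head q ⟧) (lookup-u y z) (lookup-v y z)))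
        (2*∑∑-xor m)

  -- `disjoint` expresses distinctness of the vertices of the pairs through its effect on weights:
  -- the senders that a hub hears are shared out among the pairs.
  module _ (R : ℕ) (c : Configuration) {M : ℕ} (u v : Fin M → Fin K)
           (disjoint : ∀ f → ∑ (allFin M) (λ j → f (u j) + f (v j)) ≤ ∑ (allFin K) f) where
    private
      charged : ℕ → Fin 2 → Fin M → Bool
      charged r w j = does (Pair.charged? (u j) (v j) c r w)

      pair-sends : ℕ → Fin 2 → Fin M → ℕ
      pair-sends r w j = sends c r w (u j) + sends c r w (v j)

      2≤ : ∀ r w j → pair-sends r w j ≤ 2
      2≤ r w j = +-mono-≤ (sends≤1 c r w (u j)) (sends≤1 c r w (v j))

      uncharged : ∀ r w → (∀ j → ¬ Pair.Charged (u j) (v j) c r w) → ∑ (allFin M) (λ j → ⟦ charged r w j ⟧) ≡ 0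
      uncharged r w none = trans
        (∑-cong (allFin M) (λ j → cong ⟦_⟧ (dec-false (Pair.charged? (u j) (v j) c r w) (none j))))
        (∑-zero (allFin M))

      -- If some pair is charged, at most three of the hub's neighbours transmit.
      charges-per-round : ∀ r w → ∑ (allFin M) (λ j → ⟦ charged r w j ⟧) ≤ 3 * ⟦ listening (exec c r (hub w)) ⟧
      charges-per-round r w with T? (listening (exec c r (hub w)))
      ... | no deaf = ≤-trans (≤-reflexive (uncharged r w (λ j (p , _) → deaf p))) z≤n
      ... | yes listens with ∑ (allFin K) (sends c r w) ≤? 3
      ...   | yes ≤3 = begin
        ∑ (allFin M) (λ j → ⟦ charged r w j ⟧)       ≤⟨ ∑-mono (allFin M) charged≤sends ⟩
        ∑ (allFin M) (pair-sends r w)                ≤⟨ disjoint (sends c r w) ⟩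
        ∑ (allFin K) (sends c r w)                   ≤⟨ ≤3 ⟩
        3                                            ≡⟨ cong (3 *_) (⟦⟧≡1 listens) ⟨
        3 * ⟦ listening (exec c r (hub w)) ⟧         ∎
        where
        open ≤-Reasoning
        charged≤sends : ∀ j → ⟦ charged r w j ⟧ ≤ pair-sends r w j
        charged≤sends j with absent-or (Pair.charged? (u j) (v j) c r w)
        ... | inj₁ ≡0            = ≤-trans (≤-reflexive ≡0) z≤n
        ... | inj₂ (_ , 1≤ , _) = ≤-trans (⟦⟧≤1 _) 1≤
      ...   | no ≰3 = ≤-trans (≤-reflexive (uncharged r w
                (λ j (_ , _ , total≤) → ≰3 (≤-trans total≤ (s≤s (2≤ r w j)))))) z≤n

    -- Every unfree pair owns a charge. The factor 6 is the product of the two hubs and the three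
    -- pairs that one listening round can charge.
    unfree-pairs : ∀ {e} → (∀ w → exec c R (hub w) ≢ starved) → (∀ w → energy (exec c R (hub w)) ≤ e) →
      ∑ (allFin M) (λ j → ⟦ not (Pair.free (u j) (v j) c R) ⟧) ≤ 6 * e
    unfree-pairs {e} alive energy≤e = begin
      ∑ (allFin M) (λ j → ⟦ not (Pair.free (u j) (v j) c R) ⟧)
        ≤⟨ ∑-mono (allFin M) (λ j → Pair.unfree≤charges (u j) (v j) c R) ⟩
      ∑ (allFin M) (λ j → ∑ (downFrom R) (λ r → ∑ (allFin 2) (λ w → ⟦ charged r w j ⟧)))
        ≡⟨ ∑-swap (allFin M) (downFrom R) (λ j r → ∑ (allFin 2) (λ w → ⟦ charged r w j ⟧)) ⟩
      ∑ (downFrom R) (λ r → ∑ (allFin M) (λ j → ∑ (allFin 2) (λ w → ⟦ charged r w j ⟧)))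
        ≡⟨ ∑-cong (downFrom R) (λ r → ∑-swap (allFin M) (allFin 2) (λ j w → ⟦ charged r w j ⟧)) ⟩
      ∑ (downFrom R) (λ r → ∑ (allFin 2) (λ w → ∑ (allFin M) (λ j → ⟦ charged r w j ⟧)))
        ≤⟨ ∑-mono (downFrom R) (λ r → ∑-mono (allFin 2) (charges-per-round r)) ⟩
      ∑ (downFrom R) (λ r → ∑ (allFin 2) (λ w → 3 * ⟦ listening (exec c r (hub w)) ⟧))
        ≡⟨ ∑-swap (downFrom R) (allFin 2) (λ r w → 3 * ⟦ listening (exec c r (hub w)) ⟧) ⟩
      ∑ (allFin 2) (λ w → ∑ (downFrom R) (λ r → 3 * ⟦ listening (exec c r (hub w)) ⟧))
        ≡⟨ ∑-cong (allFin 2) (λ w → ∑-* (downFrom R) 3 (λ r → ⟦ listening (exec c r (hub w)) ⟧)) ⟩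
      ∑ (allFin 2) (λ w → 3 * ∑ (downFrom R) (λ r → ⟦ listening (exec c r (hub w)) ⟧))
        ≤⟨ ∑-mono (allFin 2) (λ w → *-monoʳ-≤ 3 (listens≤e w)) ⟩
      ∑ (allFin 2) (λ w → 3 * e)
        ≡⟨ lemma e ⟩
      6 * e ∎
      where
      open ≤-Reasoning
      listens≤e : ∀ w → ∑ (downFrom R) (λ r → ⟦ listening (exec c r (hub w)) ⟧) ≤ e
      listens≤e w = begin
        ∑ (downFrom R) (λ r → ⟦ listening (exec c r (hub w)) ⟧)
          -- `listens≤energy` also counts round `R`, whose action is already chosen and paid for.
          ≤⟨ m≤n+m _ ⟦ listening (exec c R (hub w)) ⟧ ⟩
        ∑ (downFrom (suc R)) (λ r → ⟦ listening (exec c r (hub w)) ⟧)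
          ≤⟨ listens≤energy (link (types c)) σ (tapes c) (hub w) R (alive w) ⟩
        energy (exec c R (hub w))
          ≤⟨ energy≤e w ⟩
        e ∎
      lemma : ∀ e → 3 * e + (3 * e + 0) ≡ 6 * e
      lemma = solve-∀

length-coins : ∀ m → length (coins m) ≡ 2 ^ m
length-coins = length-vectors bits

length-coins>0 : ∀ m → NonZero (length (coins m))
length-coins>0 m = subst NonZero (sym (length-coins m)) (m^n≢0 2 m)

length-allFin : ∀ n → length (allFin n) ≡ n
length-allFin n = length-tabulate (λ x → x)

-- Averaging over the pairs, with the coins of three vertices fixed

module Slice (A : Algorithm) {N m : ℕ} (σ : Fin (3 + N) → Algorithm.State A)
             (σ-uniform : ∀ i j → σ (suc (suc i)) ≡ σ (suc (suc j)))
             (a b d : Coins m) where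
  open Execution A
  open Simulation A
  open Network σ σ-uniform a b
  open Counting A σ σ-uniform a b

  -- The added entry is the vertex that is always adjacent to t. Its type must not be resampled, so
  -- all pairs are taken among the other `N` vertices.
  extend : Vec (Coins (suc m)) N → Configuration
  extend c = (true ∷ᵛ d) ∷ᵛ c

  module _ (R : ℕ) {M : ℕ} (u v : Fin M → Fin N) (u≢v : ∀ j → u j ≢ v j)
           (disjoint : ∀ f → ∑ (allFin M) (λ j → f (u j) + f (v j)) ≤ ∑ (allFin N) f)
           (e : ℕ) (energy≤e : ∀ c → (∀ q → exec (extend c) R q ≢ starved) → ∀ q → energy (exec (extend c) R q) ≤ e) where
    private
      Cs : List (Vec (Coins (suc m)) N)
      Cs = vectors (coins (suc m)) N

      L V F : ℕ
      L = length (coins (suc m))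
      V = length Cs
      F = ∑ Cs (wrong R ∘ extend)

      u′ v′ : Fin M → Fin (suc N)
      u′ j = suc (u j)
      v′ j = suc (v j)

      u′≢v′ : ∀ j → u′ j ≢ v′ j
      u′≢v′ j = u≢v j ∘ suc-injective

      disjoint′ : ∀ f → ∑ (allFin M) (λ j → f (u′ j) + f (v′ j)) ≤ ∑ (allFin (suc N)) f
      disjoint′ f = ≤-trans (disjoint (f ∘ suc)) (≤-trans (m≤n+m _ (f zero)) (≤-reflexive (sym (∑-allFin-suc f))))

      mix : Fin M → Configuration → ℕ
      mix j = mixed (u′ j) (v′ j)

      isFree : Fin M → Configuration → Bool
      isFree j c = Pair.free (u′ j) (v′ j) c R

      cancel-L² : ∀ {x y} → L * (L * x) ≤ L * (L * y) → x ≤ y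
      cancel-L² {x} {y} le = *-cancelˡ-≤ L {{length-coins>0 (suc m)}} (*-cancelˡ-≤ L {{length-coins>0 (suc m)}} le)

      resampled : ∀ j (G : Configuration → ℕ) →
        ∑ Cs (λ c → ∑ (coins (suc m)) (λ y → ∑ (coins (suc m)) (λ z → G (extend c [ u′ j ]≔ y [ v′ j ]≔ z)))) ≡
        L * (L * ∑ Cs (G ∘ extend))
      resampled j G = ∑-resample₂ (coins (suc m)) (u j) (v j) (G ∘ extend)

      -- The comparison holds for every fixed rest, summed over both entries of the pair; resampling
      -- turns this into `L * L` copies of the sums over all configurations.
      ∑-mixed-free≤F : ∀ j → ∑ Cs (λ c → mix j (extend c) * ⟦ isFree j (extend c) ⟧) ≤ F
      ∑-mixed-free≤F j = cancel-L² (begin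
        L * (L * ∑ Cs (λ c → mix j (extend c) * ⟦ isFree j (extend c) ⟧))
          ≡⟨ resampled j (λ c → mix j c * ⟦ isFree j c ⟧) ⟨
        _ ≤⟨ ∑-mono Cs (λ c → mixed-free≤wrong R (u′≢v′ j) (extend c)) ⟩
        _ ≡⟨ resampled j (wrong R) ⟩
        L * (L * F) ∎)
        where open ≤-Reasoning

      -- Two independent fair bits differ in half of the cases.
      V≤2*∑-mixed : ∀ j → V ≤ 2 * ∑ Cs (mix j ∘ extend)
      V≤2*∑-mixed j = cancel-L² (≤-reflexive (begin
        L * (L * V)
          ≡⟨ lemma L V ⟩
        V * (L * L)
          ≡⟨ ∑-const Cs (L * L) ⟨
        ∑ Cs (λ c → L * L)
          ≡⟨ ∑-cong Cs (λ c → 2*mixed R (u′≢v′ j) (extend c)) ⟨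
        ∑ Cs (λ c → 2 * ∑ (coins (suc m)) (λ y → ∑ (coins (suc m)) (λ z → mix j (extend c [ u′ j ]≔ y [ v′ j ]≔ z))))
          ≡⟨ ∑-* Cs 2 _ ⟩
        2 * ∑ Cs (λ c → ∑ (coins (suc m)) (λ y → ∑ (coins (suc m)) (λ z → mix j (extend c [ u′ j ]≔ y [ v′ j ]≔ z))))
          ≡⟨ cong (2 *_) (resampled j (mix j)) ⟩
        2 * (L * (L * ∑ Cs (mix j ∘ extend)))
          ≡⟨ lemma₂ L _ ⟩
        L * (L * (2 * ∑ Cs (mix j ∘ extend))) ∎))
        where
        open ≡-Reasoning
        lemma : ∀ l v → l * (l * v) ≡ v * (l * l)
        lemma = solve-∀
        lemma₂ : ∀ l x → 2 * (l * (l * x)) ≡ l * (l * (2 * x))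
        lemma₂ = solve-∀

      mixedFree : Configuration → ℕ
      mixedFree c = ∑ (allFin M) (λ j → mix j c * ⟦ isFree j c ⟧)

      mix≤1 : ∀ j c → mix j c ≤ 1
      mix≤1 j c = ⟦⟧≤1 (Vec.head (lookup c (u′ j)) xor Vec.head (lookup c (v′ j)))

      -- The energy bound may be invoked only if no device is starved, which correctness guarantees
      -- because a starved device has no output. In a wrong run all `M` pairs are given up instead.
      mixed≤ : ∀ c₀ → let c = extend c₀ in
        ∑ (allFin M) (λ j → mix j c) ≤ mixedFree c + (6 * e + M * wrong R c)
      mixed≤ c₀ with refuted-or (correct? (extend c₀) R)
      ... | inj₁ refuted = begin
        ∑ (allFin M) (λ j → mix j c)  ≤⟨ ∑-mono (allFin M) (λ j → mix≤1 j c) ⟩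
        ∑ (allFin M) (λ _ → 1)        ≡⟨ length≡∑1 (allFin M) ⟨
        length (allFin M)             ≡⟨ length-allFin M ⟩
        M                             ≡⟨ *-identityʳ M ⟨
        M * 1                         ≡⟨ cong (M *_) refuted ⟨
        M * wrong R c                 ≤⟨ m≤n+m (M * wrong R c) (6 * e) ⟩
        6 * e + M * wrong R c         ≤⟨ m≤n+m (6 * e + M * wrong R c) (mixedFree c) ⟩
        mixedFree c + (6 * e + M * wrong R c) ∎
        where
        open ≤-Reasoning
        c = extend c₀
      ... | inj₂ correct = begin
        ∑ (allFin M) (λ j → mix j c)
          ≤⟨ ∑-mono (allFin M) (λ j → split (Vec.head (lookup c (u′ j)) xor Vec.head (lookup c (v′ j))) (isFree j c)) ⟩
        ∑ (allFin M) (λ j → mix j c * ⟦ isFree j c ⟧ + ⟦ not (isFree j c) ⟧)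
          ≡⟨ ∑-+ (allFin M) (λ j → mix j c * ⟦ isFree j c ⟧) (λ j → ⟦ not (isFree j c) ⟧) ⟩
        mixedFree c + ∑ (allFin M) (λ j → ⟦ not (isFree j c) ⟧)
          ≤⟨ +-monoʳ-≤ (mixedFree c)
               (unfree-pairs R c u′ v′ disjoint′ (alive ∘ hub) (energy≤e c₀ alive ∘ hub)) ⟩
        mixedFree c + 6 * e
          ≤⟨ +-monoʳ-≤ (mixedFree c) (m≤m+n (6 * e) (M * wrong R c)) ⟩
        mixedFree c + (6 * e + M * wrong R c) ∎
        where
        open ≤-Reasoning
        c = extend c₀
        split : ∀ x y → ⟦ x ⟧ ≤ ⟦ x ⟧ * ⟦ y ⟧ + ⟦ not y ⟧
        split true  true  = ≤-refl
        split true  false = ≤-refl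
        split false y     = z≤n
        alive : ∀ q → exec c R q ≢ starved
        alive q eq with () ← trans (sym (correct q)) (cong output eq)

    -- Half of all pairs are mixed on average, whence an overall factor 2. Failures then appear
    -- twice, once as the bound for mixed free pairs and once for the runs given up in `mixed≤`,
    -- which makes 4; the unfree pairs contribute 2 times 6.
    pairs*size≤ : M * length (vectors (coins (suc m)) N) ≤
      4 * (M * ∑ (vectors (coins (suc m)) N) (wrong R ∘ extend)) + 12 * e * length (vectors (coins (suc m)) N)
    pairs*size≤ = begin
      M * V
        ≡⟨ cong (_* V) (length-allFin M) ⟨
      length (allFin M) * V
        ≡⟨ ∑-const (allFin M) V ⟨
      ∑ (allFin M) (λ _ → V)
        ≤⟨ ∑-mono (allFin M) V≤2*∑-mixed ⟩
      ∑ (allFin M) (λ j → 2 * ∑ Cs (mix j ∘ extend))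
        ≡⟨ ∑-* (allFin M) 2 (λ j → ∑ Cs (mix j ∘ extend)) ⟩
      2 * ∑ (allFin M) (λ j → ∑ Cs (mix j ∘ extend))
        ≡⟨ cong (2 *_) (∑-swap (allFin M) Cs (λ j c → mix j (extend c))) ⟩
      2 * ∑ Cs (λ c → ∑ (allFin M) (λ j → mix j (extend c)))
        ≤⟨ *-monoʳ-≤ 2 (∑-mono Cs mixed≤) ⟩
      2 * ∑ Cs (λ c → P c + (6 * e + M * wrong R (extend c)))
        ≡⟨ cong (2 *_) (∑-+ Cs P (λ c → 6 * e + M * wrong R (extend c))) ⟩
      2 * (∑ Cs P + ∑ Cs (λ c → 6 * e + M * wrong R (extend c)))
        ≡⟨ cong (λ x → 2 * (∑ Cs P + x)) (∑-+ Cs (λ _ → 6 * e) (λ c → M * wrong R (extend c))) ⟩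
      2 * (∑ Cs P + (∑ Cs (λ _ → 6 * e) + ∑ Cs (λ c → M * wrong R (extend c))))
        ≡⟨ cong₂ (λ x y → 2 * (∑ Cs P + (x + y))) (∑-const Cs (6 * e)) (∑-* Cs M (wrong R ∘ extend)) ⟩
      2 * (∑ Cs P + (V * (6 * e) + M * F))
        ≤⟨ *-monoʳ-≤ 2 (+-monoˡ-≤ (V * (6 * e) + M * F) ∑P≤) ⟩
      2 * (M * F + (V * (6 * e) + M * F))
        ≡⟨ lemma (M * F) V e ⟩
      4 * (M * F) + 12 * e * V ∎
      where
      open ≤-Reasoning
      P : Vec (Coins (suc m)) N → ℕ
      P = mixedFree ∘ extend
      ∑P≤ : ∑ Cs P ≤ M * F
      ∑P≤ = begin
        ∑ Cs P
          ≡⟨ ∑-swap Cs (allFin M) (λ c j → mix j (extend c) * ⟦ isFree j (extend c) ⟧) ⟩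
        ∑ (allFin M) (λ j → ∑ Cs (λ c → mix j (extend c) * ⟦ isFree j (extend c) ⟧))
          ≤⟨ ∑-mono (allFin M) ∑-mixed-free≤F ⟩
        ∑ (allFin M) (λ _ → F)
          ≡⟨ ∑-const (allFin M) F ⟩
        length (allFin M) * F
          ≡⟨ cong (_* F) (length-allFin M) ⟩
        M * F ∎
      lemma : ∀ x v e → 2 * (x + (v * (6 * e) + x)) ≡ 4 * x + 12 * e * v
      lemma = solve-∀

-- Fractions

toℚᵘ-/ : ∀ a b → ℚ.toℚᵘ (ℤ.+ a / suc b) ℚᵘ.≃ mkℚᵘ (ℤ.+ a) b
toℚᵘ-/ a b = ℚ.toℚᵘ-fromℚᵘ (mkℚᵘ (ℤ.+ a) b)

/-mono-≤ : ∀ a b c d .{{_ : NonZero b}} .{{_ : NonZero d}} → a * d ≤ c * b → ℤ.+ a / b ℚ.≤ ℤ.+ c / d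
/-mono-≤ a (suc b) c (suc d) ad≤cb = ℚ.toℚᵘ-cancel-≤
  (ℚᵘ.≤-respˡ-≃ (ℚᵘ.≃-sym (toℚᵘ-/ a b)) (ℚᵘ.≤-respʳ-≃ (ℚᵘ.≃-sym (toℚᵘ-/ c d))
    (ℚᵘ.*≤* (subst₂ ℤ._≤_ (ℤ.pos-* a (suc d)) (ℤ.pos-* c (suc b)) (ℤ.+≤+ ad≤cb)))))

/-cancel-≤ : ∀ a b c d .{{_ : NonZero b}} .{{_ : NonZero d}} → ℤ.+ a / b ℚ.≤ ℤ.+ c / d → a * d ≤ c * b
/-cancel-≤ a (suc b) c (suc d) le = ℤ.drop‿+≤+ (subst₂ ℤ._≤_ (sym (ℤ.pos-* a (suc d))) (sym (ℤ.pos-* c (suc b)))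
  (ℚᵘ.drop-*≤* (ℚᵘ.≤-respˡ-≃ (toℚᵘ-/ a b) (ℚᵘ.≤-respʳ-≃ (toℚᵘ-/ c d) (ℚ.toℚᵘ-mono-≤ le)))))

1/[1+k]*n≡n/[1+k] : ∀ k n → ℤ.+ 1 / suc k ℚ.* (ℤ.+ n / 1) ≡ ℤ.+ n / suc k
1/[1+k]*n≡n/[1+k] k n = ℚ.toℚᵘ-injective (begin
  ℚ.toℚᵘ (ℤ.+ 1 / suc k ℚ.* (ℤ.+ n / 1))
    ≈⟨ ℚ.toℚᵘ-homo-* (ℤ.+ 1 / suc k) (ℤ.+ n / 1) ⟩
  ℚ.toℚᵘ (ℤ.+ 1 / suc k) ℚᵘ.* ℚ.toℚᵘ (ℤ.+ n / 1)
    ≈⟨ ℚᵘ.*-cong (toℚᵘ-/ 1 k) (toℚᵘ-/ n 0) ⟩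
  mkℚᵘ (ℤ.+ 1) k ℚᵘ.* mkℚᵘ (ℤ.+ n) 0
    ≈⟨ ℚᵘ.*≡* (cong₂ ℤ._*_ (ℤ.*-identityˡ (ℤ.+ n)) (cong ℤ.+_ (sym (*-identityʳ (suc k))))) ⟩
  mkℚᵘ (ℤ.+ n) k
    ≈⟨ toℚᵘ-/ n k ⟨
  ℚ.toℚᵘ (ℤ.+ n / suc k) ∎)
  where open ℚᵘ.≃-Reasoning

-- Monotonicity of success in coins and rounds

module _ (A : Algorithm) {n : ℕ} (I : Instance n) (c : ℕ) where
  open Algorithm A
  open Execution A
  open Simulation A

  -- Read "holds the same coins, and possibly more".
  data _⊑_ : Device → Device → Set where
    acting  : ∀ {e a cs ds} → acting e a cs ⊑ acting e a (cs ++ ds)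
    halted  : ∀ {e o} → halted e o ⊑ halted e o
    starved : ∀ {d} → starved ⊑ d

  resume-⊑ : ∀ e q cs ds → resume e q cs ⊑ resume e q (cs ++ ds)
  resume-⊑ e q cs ds with program q
  ... | act a  = acting
  ... | halt o = halted
  resume-⊑ e q []       ds | toss k = starved
  resume-⊑ e q (b ∷ cs) ds | toss k = resume-⊑ e (k b) cs ds

  finishRound-⊑ : ∀ f {d d′} → d ⊑ d′ → finishRound f d ⊑ finishRound f d′
  finishRound-⊑ f (acting {e} {listen k} {cs} {ds})     = resume-⊑ e (k f) cs ds
  finishRound-⊑ f (acting {e} {transmit _ q} {cs} {ds}) = resume-⊑ e q cs ds
  finishRound-⊑ f (acting {e} {idle q} {cs} {ds})       = resume-⊑ e q cs ds
  finishRound-⊑ f halted                                = halted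
  finishRound-⊑ f starved                               = starved

  sent-⊑ : ∀ {d d′} → d ⊑ d′ → d ≢ starved → sent d ≡ sent d′
  sent-⊑ (acting {a = listen _})     _     = refl
  sent-⊑ (acting {a = transmit _ _}) _     = refl
  sent-⊑ (acting {a = idle _})       _     = refl
  sent-⊑ halted                      _     = refl
  sent-⊑ starved                     alive = ⊥-elim (alive refl)

  output-⊑ : ∀ {d d′ o} → d ⊑ d′ → output d ≡ just o → output d′ ≡ just o
  output-⊑ halted eq = eq

  toList-init : ∀ {m} (w : Coins (suc m)) → toList w ≡ toList (Vec.init w) ++ List.[ Vec.last w ]
  toList-init w with Vec.initLast w
  ... | xs , x , refl = toList-∷ʳ x xs

  -- A starved device sends nothing, but with another coin it might transmit and change what its
  -- neighbours hear. Determinedness excludes this, and it passes to earlier rounds because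
  -- starvation is permanent.
  run-⊑ : ∀ {m} (ω : Vec (Coins (suc m)) n) r → Determined I (Vec.map Vec.init ω) r →
          ∀ v → run I (Vec.map Vec.init ω) r v ⊑ run I ω r v
  run-⊑ ω zero det v rewrite lookup-map v Vec.init ω | toList-init (lookup ω v) =
    resume-⊑ 0 _ (toList (Vec.init (lookup ω v))) _
  run-⊑ ω (suc r) det v = subst (λ f → run I ω′ (suc r) v ⊑ finishRound f (run I ω r v))
    (cong feedback (inbox-cong adj adj (run I ω′ r) (run I ω r) v v same))
    (finishRound-⊑ (heard I (run I ω′ r) v) (run-⊑ ω r det′ v))
    where
    open Instance I using (adj)
    ω′ = Vec.map Vec.init ω
    det′ : Determined I ω′ r
    det′ v eq = det v (cong (finishRound (heard I (run I ω′ r) v)) eq)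
    same : ∀ u → gate (adj v u) (sent (run I ω′ r u)) ≡ gate (adj v u) (sent (run I ω r u))
    same u = cong (gate (adj v u)) (sent-⊑ (run-⊑ ω r det′ u) (det′ u))

  successes : ℕ → ℕ → ℕ
  successes m r = ∑ (allCoins n m) (λ ω → ⟦ does (allOutput? I c ω r) ⟧)

  ⟦does⟧-mono : ∀ {P Q : Set} (p? : Dec P) (q? : Dec Q) → (P → Q) → ⟦ does p? ⟧ ≤ ⟦ does q? ⟧
  ⟦does⟧-mono (yes p) q? p⇒q rewrite dec-true q? (p⇒q p) = ≤-refl
  ⟦does⟧-mono (no _)  q? p⇒q = z≤n

  allOutput-suc : ∀ {m} (ω : Vec (Coins m) n) r → AllOutput I c ω r → AllOutput I c ω (suc r)
  allOutput-suc ω r all v = finished (run I ω r v) (all v)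
    where
    finished : ∀ d → output d ≡ just c → output (finishRound (heard I (run I ω r) v) d) ≡ just c
    finished (halted _ _) eq = eq

  allOutput-init : ∀ {m} (ω : Vec (Coins (suc m)) n) r →
    AllOutput I c (Vec.map Vec.init ω) r → AllOutput I c ω r
  allOutput-init ω r all v = output-⊑ (run-⊑ ω r alive v) (all v)
    where
    alive : Determined I (Vec.map Vec.init ω) r
    alive v eq with () ← trans (sym (all v)) (cong output eq)

  -- Success probability at least 7/8, with denominators cleared. It leaves failures at most 1/8,
  -- which the factor 4 of `pairs*size≤` turns into half of the left side there.
  Likely : ℕ → ℕ → Set
  Likely m r = 7 * 2 ^ (m * n) ≤ 8 * successes m r

  likely-suc-rounds : ∀ {m r} → Likely m r → Likely m (suc r)
  likely-suc-rounds {m} {r} likely = ≤-trans likely (*-monoʳ-≤ 8 (∑-mono (allCoins n m)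
    (λ ω → ⟦does⟧-mono (allOutput? I c ω r) (allOutput? I c ω (suc r)) (allOutput-suc ω r))))

  -- One more coin per device multiplies the number of tapes by `2 ^ n`, and likewise the successes
  -- already counted, as these do not reach the new coins.
  likely-suc-coins : ∀ {m r} → Likely m r → Likely (suc m) r
  likely-suc-coins {m} {r} likely = begin
    7 * 2 ^ (n + m * n)
      ≡⟨ cong (7 *_) (^-distribˡ-+-* 2 n (m * n)) ⟩
    7 * (2 ^ n * 2 ^ (m * n))
      ≡⟨ comm 7 (2 ^ n) _ ⟩
    2 ^ n * (7 * 2 ^ (m * n))
      ≤⟨ *-monoʳ-≤ (2 ^ n) likely ⟩
    2 ^ n * (8 * successes m r)
      ≡⟨ comm (2 ^ n) 8 _ ⟩
    8 * (2 ^ n * successes m r)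
      ≡⟨ cong (8 *_) (∑-vectors-map (coins (suc m)) (coins m) Vec.init 2 (∑-coins-init m) n
                        (λ ω → ⟦ does (allOutput? I c ω r) ⟧)) ⟨
    8 * ∑ (allCoins n (suc m)) (λ ω → ⟦ does (allOutput? I c (Vec.map Vec.init ω) r) ⟧)
      ≤⟨ *-monoʳ-≤ 8 (∑-mono (allCoins n (suc m)) (λ ω →
           ⟦does⟧-mono (allOutput? I c (Vec.map Vec.init ω) r) (allOutput? I c ω r) (allOutput-init ω r))) ⟩
    8 * successes (suc m) r ∎
    where
    open ≤-Reasoning
    comm : ∀ x y z → x * (y * z) ≡ y * (x * z)
    comm = solve-∀

  likely-+ : ∀ {m r} k l → Likely m r → Likely (k + m) (l + r)
  likely-+ zero    zero    likely = likely
  likely-+ {m} {r} zero (suc l) likely = likely-suc-rounds {m} {l + r} (likely-+ zero l likely)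
  likely-+ {m} {r} (suc k) l likely = likely-suc-coins {k + m} {l + r} (likely-+ k l likely)

  likely : ∀ q .{{_ : NonZero q}} C → 16 * C ≤ q → ProbOutput≥ A I c (1ℚ ℚ.- ℤ.+ C / q) → ∃[ m ] ∃[ r ] Likely m r
  likely q C 16C≤q prob = let m , r , bound = prob (ℤ.+ 1 / 16) (ℚ.*<* (ℤ.+<+ (s≤s z≤n))) in m , r , likely-of m r bound
    where
    open ≤-Reasoning
    7/8≤ : ℤ.+ 7 / 8 ℚ.≤ 1ℚ ℚ.- ℤ.+ C / q ℚ.- ℤ.+ 1 / 16
    -- `7 / 8` is `1 - 1/16 - 1/16` by computation: one sixteenth is the allowed error `C / q`, the
    -- other the ε granted to finitely many coins and rounds.
    7/8≤ = ℚ.+-monoˡ-≤ (ℚ.- (ℤ.+ 1 / 16)) (ℚ.+-monoʳ-≤ 1ℚ (ℚ.neg-antimono-≤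
      (/-mono-≤ C q 1 16 (subst₂ _≤_ (*-comm 16 C) (sym (+-identityʳ q)) 16C≤q))))
    likely-of : ∀ m r → 1ℚ ℚ.- ℤ.+ C / q ℚ.- ℤ.+ 1 / 16 ℚ.≤ probOutputWithin A I c m r → Likely m r
    likely-of m r bound = begin
      7 * 2 ^ (m * n)
        ≤⟨ /-cancel-≤ 7 8 (length (filter (λ ω → allOutput? I c ω r) (allCoins n m)))
             (2 ^ (m * n)) {{_}} {{m^n≢0 2 (m * n)}} (ℚ.≤-trans 7/8≤ bound) ⟩
      length (filter (λ ω → allOutput? I c ω r) (allCoins n m)) * 8
        ≡⟨ cong (_* 8) (length-filter (λ ω → allOutput? I c ω r) (allCoins n m)) ⟩
      successes m r * 8
        ≡⟨ *-comm (successes m r) 8 ⟩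
      8 * successes m r ∎

-- Each network comes with its own numbers of coins and rounds, but summing over all types needs
-- common ones. There are finitely many types, and by monotonicity the sums of the numbers for the
-- two values of a bit serve both.
uniform : ∀ N (P : Vec Bool N → ℕ → ℕ → Set) → (∀ x {m r} k l → P x m r → P x (k + m) (l + r)) →
  (∀ x → ∃[ m ] ∃[ r ] P x m r) → ∃[ m ] ∃[ r ] (∀ x → P x m r)
uniform zero    P mono ex with m , r , p ← ex []ᵛ = m , r , λ { []ᵛ → p }
uniform (suc N) P mono ex
  with m , r , p ← uniform N (λ x → P (true ∷ᵛ x)) (λ x → mono (true ∷ᵛ x)) (λ x → ex (true ∷ᵛ x))
     | m′ , r′ , p′ ← uniform N (λ x → P (false ∷ᵛ x)) (λ x → mono (false ∷ᵛ x)) (λ x → ex (false ∷ᵛ x)) =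
  m + m′ , r + r′ , λ where
    (true  ∷ᵛ x) → subst₂ (P (true ∷ᵛ x)) (+-comm m′ m) (+-comm r′ r) (mono (true ∷ᵛ x) m′ r′ (p x))
    (false ∷ᵛ x) → mono (false ∷ᵛ x) m r (p′ x)

-- The lower bound

∑³ : ∀ {A : Set} → List A → (A → A → A → ℕ) → ℕ
∑³ xs f = ∑ xs (λ a → ∑ xs (λ b → ∑ xs (λ d → f a b d)))

∑³-mono : ∀ {A : Set} (xs : List A) {f g} → (∀ a b d → f a b d ≤ g a b d) → ∑³ xs f ≤ ∑³ xs g
∑³-mono xs f≤g = ∑-mono xs λ a → ∑-mono xs λ b → ∑-mono xs λ d → f≤g a b d

∑³-cong : ∀ {A : Set} (xs : List A) {f g} → (∀ a b d → f a b d ≡ g a b d) → ∑³ xs f ≡ ∑³ xs g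
∑³-cong xs f≡g = ∑-cong xs λ a → ∑-cong xs λ b → ∑-cong xs λ d → f≡g a b d

∑³-+ : ∀ {A : Set} (xs : List A) f g → ∑³ xs (λ a b d → f a b d + g a b d) ≡ ∑³ xs f + ∑³ xs g
∑³-+ xs f g =
  trans (∑-cong xs λ a → trans (∑-cong xs λ b → ∑-+ xs (f a b) (g a b))
                               (∑-+ xs (λ b → ∑ xs (f a b)) (λ b → ∑ xs (g a b))))
        (∑-+ xs (λ a → ∑ xs λ b → ∑ xs (f a b)) (λ a → ∑ xs λ b → ∑ xs (g a b)))

∑³-* : ∀ {A : Set} (xs : List A) k f → ∑³ xs (λ a b d → k * f a b d) ≡ k * ∑³ xs f
∑³-* xs k f =
  trans (∑-cong xs λ a → trans (∑-cong xs λ b → ∑-* xs k (f a b)) (∑-* xs k (λ b → ∑ xs (f a b))))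
        (∑-* xs k (λ a → ∑ xs λ b → ∑ xs (f a b)))

∑-vectors-3+ : ∀ {A : Set} (xs : List A) n F → ∑ (vectors xs (3 + n)) F ≡
  ∑³ xs (λ a b d → ∑ (vectors xs n) (λ w → F (a ∷ᵛ b ∷ᵛ d ∷ᵛ w)))
∑-vectors-3+ xs n F = trans (∑-vectors-suc xs (2 + n) F) (∑-cong xs λ a →
  trans (∑-vectors-suc xs (1 + n) (λ w → F (a ∷ᵛ w))) (∑-cong xs λ b →
  ∑-vectors-suc xs n (λ w → F (a ∷ᵛ b ∷ᵛ w))))

∑-∑³ : ∀ {A B : Set} (ys : List B) (xs : List A) (f : B → A → A → A → ℕ) →
  ∑ ys (λ y → ∑³ xs (f y)) ≡ ∑³ xs (λ a b d → ∑ ys (λ y → f y a b d))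
∑-∑³ ys xs f =
  trans (∑-swap ys xs (λ y a → ∑ xs λ b → ∑ xs λ d → f y a b d)) (∑-cong xs λ a →
  trans (∑-swap ys xs (λ y b → ∑ xs λ d → f y a b d)) (∑-cong xs λ b →
  ∑-swap ys xs (λ y d → f y a b d)))

-- Choosing a network and then the coins amounts to fixing the coins of s, t and the permanent
-- neighbour of t, and giving each remaining vertex a tape whose head is its type. This passes from
-- the given success probabilities to the slices.
∑-types-coins : ∀ m N (G : Vec Bool N → Vec (Coins m) (3 + N) → ℕ) →
  ∑ (coins N) (λ x → ∑ (allCoins (3 + N) m) (G x)) ≡
  ∑³ (coins m) (λ a b d → ∑ (vectors (coins (suc m)) N)
    (λ c → G (Vec.map Vec.head c) (a ∷ᵛ b ∷ᵛ d ∷ᵛ Vec.map Vec.tail c)))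
∑-types-coins m N G = begin
  ∑ (coins N) (λ x → ∑ (allCoins (3 + N) m) (G x))
    ≡⟨ ∑-cong (coins N) (λ x → ∑-vectors-3+ (coins m) N (G x)) ⟩
  ∑ (coins N) (λ x → ∑³ (coins m) (λ a b d → ∑ (vectors (coins m) N) (λ w → G x (a ∷ᵛ b ∷ᵛ d ∷ᵛ w))))
    ≡⟨ ∑-∑³ (coins N) (coins m) (λ x a b d → ∑ (vectors (coins m) N) (λ w → G x (a ∷ᵛ b ∷ᵛ d ∷ᵛ w))) ⟩
  ∑³ (coins m) (λ a b d → ∑ (coins N) (λ x → ∑ (vectors (coins m) N) (λ w → G x (a ∷ᵛ b ∷ᵛ d ∷ᵛ w))))
    ≡⟨ ∑³-cong (coins m) (λ a b d → ∑-vectors-heads-tails m N (λ x w → G x (a ∷ᵛ b ∷ᵛ d ∷ᵛ w))) ⟨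
  _ ∎
  where open ≡-Reasoning

halves : ∀ n → ∃[ k ] ∃[ p ] (n ≡ k + (k + p) × p ≤ 1)
halves zero          = 0 , 0 , refl , z≤n
halves (suc zero)    = 0 , 1 , refl , ≤-refl
halves (suc (suc n)) with k , p , refl , p≤1 ← halves n =
  suc k , p , cong suc (sym (+-suc k (k + p))) , p≤1

module _ (A : Algorithm) {n : ℕ} (I : Instance n) where
  open Algorithm A
  open Execution A
  open Simulation A
  open Instance I using (adj)

  -- Replaces what the start states read off the instance, Δ and the roles, by values that do not
  -- mention the types, so that runs in different networks become comparable.
  run≡simulate : ∀ {m} (ω : Vec (Coins m) n) Δ (ρ : Fin n → Role) (τ : Fin n → List Bool) →
    Graph.maxDegree (Instance.graph I) ≡ Δ → (∀ v → role I v ≡ ρ v) → (∀ v → toList (lookup ω v) ≡ τ v) →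
    ∀ r v → run I ω r v ≡ simulate adj (λ v → start n Δ (ρ v)) τ r v
  run≡simulate ω Δ ρ τ refl ρ≡ τ≡ zero v = cong₂ (λ role → resume 0 (start n Δ role)) (ρ≡ v) (τ≡ v)
  run≡simulate ω Δ ρ τ Δ≡ ρ≡ τ≡ (suc r) v = cong₂ finishRound
    (cong feedback (inbox-cong-≡ adj adj (run I ω r) (simulate adj (λ v → start n Δ (ρ v)) τ r) v v
      (λ _ → refl) (λ u _ → run≡simulate ω Δ ρ τ Δ≡ ρ≡ τ≡ r u)))
    (run≡simulate ω Δ ρ τ Δ≡ ρ≡ τ≡ r v)

module Halves (M p : ℕ) where
  u v : Fin M → Fin (M + (M + p))
  u j = j ↑ˡ (M + p)
  v j = M ↑ʳ (j ↑ˡ p)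

  u≢v : ∀ j → u j ≢ v j
  u≢v j eq = <⇒≢ (≤-trans (toℕ<n j) (m≤m+n M _))
    (trans (sym (toℕ-↑ˡ j (M + p))) (trans (cong toℕ eq) (toℕ-↑ʳ M (j ↑ˡ p))))

  disjoint : ∀ f → ∑ (allFin M) (λ j → f (u j) + f (v j)) ≤ ∑ (allFin (M + (M + p))) f
  disjoint f = begin
    ∑ (allFin M) (λ j → f (u j) + f (v j))
      ≡⟨ ∑-+ (allFin M) (f ∘ u) (f ∘ v) ⟩
    ∑ (allFin M) (f ∘ u) + ∑ (allFin M) (f ∘ v)
      ≤⟨ +-monoʳ-≤ (∑ (allFin M) (f ∘ u)) (m≤m+n (∑ (allFin M) (f ∘ v)) _) ⟩
    ∑ (allFin M) (f ∘ u) + (∑ (allFin M) (f ∘ v) + ∑ (allFin p) (λ i → f (M ↑ʳ (M ↑ʳ i))))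
      ≡⟨ cong (∑ (allFin M) (f ∘ u) +_) (∑-allFin-+ M (λ i → f (M ↑ʳ i))) ⟨
    ∑ (allFin M) (f ∘ u) + ∑ (allFin (M + p)) (λ i → f (M ↑ʳ i))
      ≡⟨ ∑-allFin-+ M f ⟨
    ∑ (allFin (M + (M + p))) f ∎
    where open ≤-Reasoning

module LowerBound (A : Algorithm) (N : ℕ) (1≤N : 1 ≤ N) where
  open Algorithm A
  open Execution A
  open Simulation A

  roleOf : Fin (3 + N) → Role
  roleOf 0F            = source
  roleOf 1F            = sink
  roleOf (suc (suc _)) = ordinary

  σ : Fin (3 + N) → State
  σ v = start (3 + N) (suc N) (roleOf v)

  answer : Vec Bool N → ℕ
  answer x = bitSum (true ∷ᵛ x)

  module _ {m : ℕ} (a b d : Coins m) where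
    open Network {suc N} {m} σ (λ _ _ → refl) a b
    open Counting A {suc N} {m} σ (λ _ _ → refl) a b
    open Slice A {N} {m} σ (λ _ _ → refl) a b d using (extend)

    types-of : Vec (Coins (suc m)) N → Vec Bool N
    types-of = Vec.map Vec.head

    coins-of : Vec (Coins (suc m)) N → Vec (Coins m) (3 + N)
    coins-of c = a ∷ᵛ b ∷ᵛ d ∷ᵛ Vec.map Vec.tail c

    role≡roleOf : ∀ x v → role (linkInstance x) v ≡ roleOf v
    role≡roleOf x 0F            = refl
    role≡roleOf x 1F            = refl
    role≡roleOf x (suc (suc _)) = refl

    tapes≡ : ∀ c v → toList (lookup (coins-of c) v) ≡ tapes (extend c) v
    tapes≡ c 0F                  = refl
    tapes≡ c 1F                  = refl
    tapes≡ c (suc (suc zero))    = refl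
    tapes≡ c (suc (suc (suc i))) = cong toList (lookup-map i Vec.tail c)

    run≡exec : ∀ c r v → run (linkInstance (types-of c)) (coins-of c) r v ≡ exec (extend c) r v
    run≡exec c = run≡simulate A (linkInstance (types-of c)) (coins-of c) (suc N) roleOf (tapes (extend c))
      (linkInstance-maxDegree (types-of c) 1≤N) (role≡roleOf (types-of c)) (tapes≡ c)

    wrong≡ : ∀ c R → wrong R (extend c) ≡
      ⟦ not (does (allOutput? (linkInstance (types-of c)) (answer (types-of c)) (coins-of c) R)) ⟧
    wrong≡ c R = cong (⟦_⟧ ∘ not) (does-⇔
      (mk⇔ (λ correct v → trans (cong output (run≡exec c R v)) (correct v))
           (λ all v → trans (cong output (sym (run≡exec c R v))) (all v)))
      (correct? (extend c) R) (allOutput? (linkInstance (types-of c)) (answer (types-of c)) (coins-of c) R))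

  -- Twice the summed slice bound has the failure term `M * (8 * F)`, which is at most `M * W`.
  -- Cancelling this against one of the two copies of `M * W` leaves twice 12 as the constant.
  pairs≤24*energy : ∀ {M} (u v : Fin M → Fin N) → (∀ j → u j ≢ v j) →
    (∀ f → ∑ (allFin M) (λ j → f (u j) + f (v j)) ≤ ∑ (allFin N) f) →
    ∀ m R → (∀ x → Likely A (linkInstance x) (answer x) m R) →
    ∀ e → EnergyComplexity≤ A (3 + N) e → M ≤ 24 * e
  pairs≤24*energy {M} u v u≢v disjoint m R likely e energy = *-cancelʳ-≤ M (24 * e) W {{W≢0}} (+-cancelˡ-≤ (M * W) _ _ (begin
    M * W + M * W
      ≡⟨ lemma₁ (M * W) ⟩
    2 * (M * W)
      ≤⟨ *-monoʳ-≤ 2 summed ⟩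
    2 * (4 * (M * F) + 12 * e * W)
      ≡⟨ lemma₂ M F e W ⟩
    M * (8 * F) + 24 * e * W
      ≤⟨ +-monoˡ-≤ (24 * e * W) (*-monoʳ-≤ M 8F≤W) ⟩
    M * W + 24 * e * W ∎))
    where
    open ≤-Reasoning
    Ω : List (Vec (Coins m) (3 + N))
    Ω = allCoins (3 + N) m
    Cs : List (Vec (Coins (suc m)) N)
    Cs = vectors (coins (suc m)) N

    success : Vec Bool N → Vec (Coins m) (3 + N) → Bool
    success x ω = does (allOutput? (linkInstance x) (answer x) ω R)

    F W : ℕ
    F = ∑ (coins N) (λ x → ∑ Ω (λ ω → ⟦ not (success x ω) ⟧))
    W = ∑ (coins N) (λ x → ∑ Ω (λ ω → 1))

    failures : Coins m → Coins m → Coins m → ℕ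
    failures a b d = ∑ Cs (λ c →
      Counting.wrong A {suc N} {m} σ (λ _ _ → refl) a b R (Slice.extend A {N} {m} σ (λ _ _ → refl) a b d c))

    F≡ : F ≡ ∑³ (coins m) failures
    F≡ = trans (∑-types-coins m N (λ x ω → ⟦ not (success x ω) ⟧))
               (∑³-cong (coins m) (λ a b d → ∑-cong Cs (λ c → sym (wrong≡ a b d c R))))

    W≡ : W ≡ ∑³ (coins m) (λ a b d → length Cs)
    W≡ = trans (∑-types-coins m N (λ _ _ → 1)) (∑³-cong (coins m) (λ a b d → sym (length≡∑1 Cs)))

    slice : ∀ a b d → M * length Cs ≤ 4 * (M * failures a b d) + 12 * e * length Cs
    slice a b d = Slice.pairs*size≤ A {N} {m} σ (λ _ _ → refl) a b d R u v u≢v disjoint e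
      (λ c alive q → subst (λ D → energy′ D ≤ e) (run≡exec a b d c R q)
        (energy (linkInstance (types-of a b d c)) (coins-of a b d c) R
          (λ w eq → alive w (trans (sym (run≡exec a b d c R w)) eq)) q))
      where
      energy′ : Device → ℕ
      energy′ = Execution.energy A

    summed : M * W ≤ 4 * (M * F) + 12 * e * W
    summed = begin
      M * W
        ≡⟨ cong (M *_) W≡ ⟩
      M * ∑³ (coins m) (λ a b d → length Cs)
        ≡⟨ ∑³-* (coins m) M (λ a b d → length Cs) ⟨
      ∑³ (coins m) (λ a b d → M * length Cs)
        ≤⟨ ∑³-mono (coins m) slice ⟩
      ∑³ (coins m) (λ a b d → 4 * (M * failures a b d) + 12 * e * length Cs)
        ≡⟨ ∑³-+ (coins m) (λ a b d → 4 * (M * failures a b d)) (λ a b d → 12 * e * length Cs) ⟩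
      ∑³ (coins m) (λ a b d → 4 * (M * failures a b d)) + ∑³ (coins m) (λ a b d → 12 * e * length Cs)
        ≡⟨ cong₂ _+_
             (trans (∑³-* (coins m) 4 (λ a b d → M * failures a b d)) (cong (4 *_) (∑³-* (coins m) M failures)))
             (∑³-* (coins m) (12 * e) (λ a b d → length Cs)) ⟩
      4 * (M * ∑³ (coins m) failures) + 12 * e * ∑³ (coins m) (λ a b d → length Cs)
        ≡⟨ cong₂ (λ f w → 4 * (M * f) + 12 * e * w) F≡ W≡ ⟨
      4 * (M * F) + 12 * e * W ∎

    length-Ω : length Ω ≡ 2 ^ (m * (3 + N))
    length-Ω = trans (length-vectors (coins m) (3 + N))
      (trans (cong (_^ (3 + N)) (length-coins m)) (^-*-assoc 2 m (3 + N)))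

    8*failures≤ : ∀ x → 8 * ∑ Ω (λ ω → ⟦ not (success x ω) ⟧) ≤ ∑ Ω (λ ω → 1)
    8*failures≤ x = +-cancelˡ-≤ (8 * S) _ _ (begin
      8 * S + 8 * ∑ Ω (λ ω → ⟦ not (success x ω) ⟧)
        ≡⟨ *-distribˡ-+ 8 S _ ⟨
      8 * (S + ∑ Ω (λ ω → ⟦ not (success x ω) ⟧))
        ≡⟨ cong (8 *_) (∑-+ Ω (λ ω → ⟦ success x ω ⟧) (λ ω → ⟦ not (success x ω) ⟧)) ⟨
      8 * ∑ Ω (λ ω → ⟦ success x ω ⟧ + ⟦ not (success x ω) ⟧)
        ≡⟨ cong (8 *_) (∑-cong Ω (λ ω → complement (success x ω))) ⟩
      8 * ∑ Ω (λ ω → 1)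
        ≡⟨ lemma₃ (∑ Ω (λ ω → 1)) ⟩
      7 * ∑ Ω (λ ω → 1) + ∑ Ω (λ ω → 1)
        ≡⟨ cong (λ l → 7 * l + ∑ Ω (λ ω → 1)) (trans (sym (length≡∑1 Ω)) length-Ω) ⟩
      7 * 2 ^ (m * (3 + N)) + ∑ Ω (λ ω → 1)
        ≤⟨ +-monoˡ-≤ (∑ Ω (λ ω → 1)) (likely x) ⟩
      8 * S + ∑ Ω (λ ω → 1) ∎)
      where
      S : ℕ
      S = successes A (linkInstance x) (answer x) m R
      complement : ∀ t → ⟦ t ⟧ + ⟦ not t ⟧ ≡ 1
      complement true  = refl
      complement false = refl
      lemma₃ : ∀ w → 8 * w ≡ 7 * w + w
      lemma₃ = solve-∀

    8F≤W : 8 * F ≤ W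
    8F≤W = ≤-trans (≤-reflexive (sym (∑-* (coins N) 8 (λ x → ∑ Ω (λ ω → ⟦ not (success x ω) ⟧)))))
                   (∑-mono (coins N) 8*failures≤)

    W≢0 : NonZero W
    W≢0 = subst NonZero (sym (trans (∑-const (coins N) (∑ Ω (λ ω → 1)))
        (cong₂ _*_ (length-coins N) (trans (sym (length≡∑1 Ω)) length-Ω))))
      (m*n≢0 (2 ^ N) (2 ^ (m * (3 + N))) {{m^n≢0 2 N}} {{m^n≢0 2 (m * (3 + N))}})

    lemma₁ : ∀ x → x + x ≡ 2 * x
    lemma₁ = solve-∀
    lemma₂ : ∀ M F e W → 2 * (4 * (M * F) + 12 * e * W) ≡ M * (8 * F) + 24 * e * W
    lemma₂ = solve-∀

module Bound (A : Algorithm) (C M p : ℕ) (p≤1 : p ≤ 1) where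
  N : ℕ
  N = M + (M + p)

  module _ (n₀≤3+N : 8 + 16 * C ≤ 3 + N) where
    open ≤-Reasoning

    8≤3+N : 8 ≤ 3 + N
    8≤3+N = ≤-trans (m≤m+n 8 (16 * C)) n₀≤3+N

    1≤N : 1 ≤ N
    1≤N = ≤-trans (s≤s z≤n) (+-cancelˡ-≤ 3 5 N 8≤3+N)

    open LowerBound A N 1≤N using (answer; pairs≤24*energy)
    open Halves M p using (u; v; u≢v; disjoint)

    likely-eventually : ∀ k → 1 ≤ k →
      (∀ x → ProbOutput≥ A (linkInstance x) (answer x) (1ℚ ℚ.- _/_ (ℤ.+ C) ((3 + N) ^ k) {{m^n≢0 (3 + N) k}})) →
      ∀ x → ∃[ m ] ∃[ r ] Likely A (linkInstance x) (answer x) m r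
    likely-eventually k 1≤k prob x =
      likely A (linkInstance x) (answer x) ((3 + N) ^ k) {{m^n≢0 (3 + N) k}} C 16C≤[3+N]^k (prob x)
      where
      16C≤[3+N]^k : 16 * C ≤ (3 + N) ^ k
      16C≤[3+N]^k = begin
        16 * C        ≤⟨ m≤n+m (16 * C) 8 ⟩
        8 + 16 * C    ≤⟨ n₀≤3+N ⟩
        3 + N         ≡⟨ ^-identityʳ (3 + N) ⟨
        (3 + N) ^ 1   ≤⟨ ^-monoʳ-≤ (3 + N) 1≤k ⟩
        (3 + N) ^ k   ∎

    M≤24e : (∀ x → ∃[ m ] ∃[ r ] Likely A (linkInstance x) (answer x) m r) →
            ∀ e → EnergyComplexity≤ A (3 + N) e → M ≤ 24 * e
    M≤24e eventually =
      let m , r , all = uniform N (λ x → Likely A (linkInstance x) (answer x))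
                                  (λ x → likely-+ A (linkInstance x) (answer x)) eventually
      in pairs≤24*energy u v u≢v disjoint m r all

    3+N≤96e : ∀ e → M ≤ 24 * e → 3 + N ≤ e * 96
    3+N≤96e e M≤ = begin
      3 + N           ≤⟨ 3+N≤4+2M ⟩
      -- The additive 4 is absorbed because `8 ≤ 3 + N ≤ 4 + 2 * M` gives `4 ≤ 2 * M`.
      4 + 2 * M       ≤⟨ +-monoˡ-≤ (2 * M) (+-cancelˡ-≤ 4 4 (2 * M) (≤-trans 8≤3+N 3+N≤4+2M)) ⟩
      2 * M + 2 * M   ≡⟨ doubled M ⟩
      4 * M           ≤⟨ *-monoʳ-≤ 4 M≤ ⟩
      4 * (24 * e)    ≡⟨ scaled e ⟩
      e * 96          ∎
      where
      odd : ∀ M → 3 + (M + (M + 1)) ≡ 4 + 2 * M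
      odd = solve-∀
      doubled : ∀ M → 2 * M + 2 * M ≡ 4 * M
      doubled = solve-∀
      scaled : ∀ e → 4 * (24 * e) ≡ e * 96
      scaled = solve-∀
      3+N≤4+2M : 3 + N ≤ 4 + 2 * M
      3+N≤4+2M = begin
        3 + (M + (M + p)) ≤⟨ +-monoʳ-≤ 3 (+-monoʳ-≤ M (+-monoʳ-≤ M p≤1)) ⟩
        3 + (M + (M + 1)) ≡⟨ odd M ⟩
        4 + 2 * M         ∎

    energy-bound : ∀ k → 1 ≤ k →
      (∀ x → ProbOutput≥ A (linkInstance x) (answer x) (1ℚ ℚ.- _/_ (ℤ.+ C) ((3 + N) ^ k) {{m^n≢0 (3 + N) k}})) →
      ∀ e → EnergyComplexity≤ A (3 + N) e → ℤ.+ 1 / 96 ℚ.* (ℤ.+ (3 + N) / 1) ℚ.≤ ℤ.+ e / 1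
    energy-bound k 1≤k prob e energy = subst (ℚ._≤ ℤ.+ e / 1) (sym (1/[1+k]*n≡n/[1+k] 95 (3 + N)))
      (/-mono-≤ (3 + N) 96 e 1 (≤-trans (≤-reflexive (*-identityʳ (3 + N)))
        (3+N≤96e e (M≤24e (likely-eventually k 1≤k prob) e energy))))

theorem1p4 : (A : Algorithm) → ComputesMinCutSizeWHP A → EnergyComplexityΩ[n] A
theorem1p4 A (k , C , 1≤k , whp) =
  -- 96 is 4 times 24: the number of vertices is at most `4 * M`, and `M` is at most 24 times the
  -- energy. In the threshold, `16 * C` brings the allowed error down to 1/16, as `1 ≤ k`, and 8
  -- makes `4 * M` large enough to cover the three special vertices and a possible unpaired one.
  ℤ.+ 1 / 96 , ℚ.*<* (ℤ.+<+ (s≤s z≤n)) , 8 + 16 * C , bound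
  where
  bound-halves : ∀ n → ∃[ M ] ∃[ p ] (n ≡ M + (M + p) × p ≤ 1) → 8 + 16 * C ≤ 3 + n →
    ∀ e → EnergyComplexity≤ A (3 + n) e → ℤ.+ 1 / 96 ℚ.* (ℤ.+ (3 + n) / 1) ℚ.≤ ℤ.+ e / 1
  bound-halves _ (M , p , refl , p≤1) n₀≤n = Bound.energy-bound A C M p p≤1 n₀≤n k 1≤k
    (λ x → whp (linkInstance x) (bitSum (true ∷ᵛ x)) (isMinCutSize-bitSum (true ∷ᵛ x)))

  bound : ∀ n → 8 + 16 * C ≤ n → ∀ e → EnergyComplexity≤ A n e →
          ℤ.+ 1 / 96 ℚ.* (ℤ.+ n / 1) ℚ.≤ ℤ.+ e / 1
  bound 1                   (s≤s ())
  bound 2                   (s≤s (s≤s ()))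
  bound (suc (suc (suc n))) n₀≤n = bound-halves n (halves n) n₀≤n
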